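{- Let $m,\ell\ge1$ be integers, set $n=m\ell$, and let $1\le s\le\ell$. The number of $(m+2)$-angulations of the once-punctured polygon $P_n^\bullet$ with exactly $s$ spokes is $m\binom{n+\ell-s-1}{n-1}$.
   Context: $P_n^\bullet$ is a disc with $n$ marked points $v_0,\ldots,v_{n-1}$ on its boundary (in clockwise order, indices mod $n$) and one marked point $\bullet$ (the puncture) in its interior. An arc is a non-self-intersecting curve in the disc whose endpoints are marked points and whose interior avoids the marked points, considered up to isotopy, and not isotopic to a boundary segment or contractible. Two arcs are non-crossing if they have non-crossing representatives in their isotopy classes. A spoke is an arc with an endpoint at $\bullet$. For $m\ge1$, an $(m+2)$-angulation of $P_n^\bullet$ is a set $T$ of pairwise non-crossing arcs such that every connected component of $P_n^\bullet\setminus T$ is an $(m+2)$-gon (sides counted with multiplicity, so e.g. a self-folded triangle counts as a triangle). -}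

module Defs where

open import Data.Bool using (Bool; T)
open import Data.Fin using (Fin; toℕ) renaming (_<_ to _<ᶠ_)
open import Data.Fin.Subset using (∣_∣)
open import Data.Nat using (ℕ; suc; _+_; _*_; _∸_; _≤_; _<_)
open import Data.Product using (Σ-syntax; ∃-syntax; _×_; proj₁)
open import Data.Sum using (_⊎_)
open import Data.Vec using (tabulate)
open import Function using (_∘_)
open import Function.Bundles using (_⇔_; Inverse)
open import Level using (0ℓ)
open import Relation.Binary using (Setoid)
open import Relation.Binary.Construct.Add.Supremum.Strict _<_ using (_<⁺_) public
import Relation.Binary.Construct.On as On
open import Relation.Binary.PropositionalEquality using (_≡_; _→-setoid_; setoid)
open import Relation.Nullary using (¬_)
open import Relation.Nullary.Construct.Add.Supremum using (_⁺; [_]; ⊤⁺) public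

-- Isotopy classes of arcs in the disc with boundary points v₀ , … , vₙ₋₁ (in
-- clockwise order) and puncture •.
--
-- The disc minus • is covered by the upper half-plane.  The integer a lies
-- over v_{a mod n}, the deck group is generated by a ↦ a + n, and • is the
-- point at infinity.  A curve from v_i to v_j lifts to a curve joining two
-- integers a and b, and up to isotopy it is the image of the semicircle over
-- [a , b]; a curve from v_i to • is the image of a vertical ray.
--   * The image of a semicircle with k = b - a is contractible if k = 0, is a
--     boundary segment if k = 1, and intersects itself if k > n, since it then
--     crosses its translate by n.  So the arcs between boundary points have
--     2 ≤ k ≤ n.
--   * k = n is the loop at v_i around • .  For n = 1 this is the boundary
--     segment, and there are no chords.
--   * A simple closed curve based at • bounds a disc with no marked points in
--     its interior, so it is contractible and gives no arc.
data Arc (n : ℕ) : Set where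
  -- chord i d cuts off the side of the disc that avoids • and whose corners
  -- are v_i , v_{i+1} , … , v_{i+k}, where k = 2 + toℕ d.
  chord : Fin n → Fin (n ∸ 1) → Arc n
  spoke : Fin n → Arc n

-- Lift α x y: the geodesic with endpoints x < y in ℕ ∪ {∞} is a lift of α.
-- Everything below is invariant under translation by n, and each configuration
-- below involves finitely many points of the cover, so it can be translated
-- into the part of the cover over ℕ.
data Lift {n : ℕ} : Arc n → ℕ ⁺ → ℕ ⁺ → Set where
  chord : ∀ i d t → Lift (chord i d) [ toℕ i + t * n ] [ toℕ i + t * n + (2 + toℕ d) ]
  spoke : ∀ i t   → Lift (spoke i)   [ toℕ i + t * n ] ⊤⁺

Interleaved : (x y z w : ℕ ⁺) → Set
Interleaved x y z w = x <⁺ z × z <⁺ y × y <⁺ w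

-- Two isotopy classes have disjoint representatives (away from endpoints) iff
-- no lift of one separates the endpoints of a lift of the other.
Crossing : ∀ {n} → Arc n → Arc n → Set
Crossing α β = ∃[ x ] ∃[ y ] ∃[ z ] ∃[ w ]
  Lift α x y × Lift β z w × (Interleaved x y z w ⊎ Interleaved z w x y)

ArcSet : ℕ → Set
ArcSet n = Arc n → Bool

infix 4 _∈_
_∈_ : ∀ {n} → Arc n → ArcSet n → Set
α ∈ S = T (S α)

NonCrossing : ∀ {n} → ArcSet n → Set
NonCrossing S = ∀ α β → α ∈ S → β ∈ S → ¬ Crossing α β

data Edge {n : ℕ} (S : ArcSet n) : ℕ ⁺ → ℕ ⁺ → Set where
  boundary : ∀ a → Edge S [ a ] [ suc a ]
  arc      : ∀ {α x y} → α ∈ S → Lift α x y → Edge S x y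

-- For i < j: consecutive corners of a k-gon with corners 0 , … , k - 1.
Adjacent : ∀ {k} → Fin k → Fin k → Set
Adjacent {k} i j = toℕ j ≡ suc (toℕ i) ⊎ (toℕ i ≡ 0 × suc (toℕ j) ≡ k)

-- For S non-crossing: a component of the complement of S that is a k-gon.  It
-- is simply connected and avoids •, so it lifts to the cover as an ideal
-- polygon whose corners lie in ℕ ∪ {∞}.  Listing these in increasing order,
-- an ideal polygon is the closure of a component upstairs iff its sides, and
-- none of its diagonals, are lifts of boundary segments or arcs of S.
-- Corners and sides are counted upstairs, hence with multiplicity: the inside
-- of a loop at v_a containing the spoke at v_a is the triangle a , a + n , ∞.
record PolygonalComponent {n : ℕ} (S : ArcSet n) (k : ℕ) : Set where
  field
    3≤k        : 3 ≤ k
    corner     : Fin k → ℕ ⁺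
    increasing : ∀ {i j} → i <ᶠ j → corner i <⁺ corner j
    edges      : ∀ {i j} → i <ᶠ j → Edge S (corner i) (corner j) ⇔ Adjacent i j

-- The (m+2)-angulations.  If S contains a spoke, every component of its
-- complement is a polygon.  If not, • is an interior point of one of the
-- components, which is then a punctured disc and not a polygon.
record IsAngulation {n : ℕ} (m : ℕ) (S : ArcSet n) : Set where
  field
    nonCrossing    : NonCrossing S
    hasSpoke       : ∃[ i ] spoke i ∈ S
    all-[m+2]-gons : ∀ k → PolygonalComponent S k → k ≡ m + 2

#spokes : ∀ {n} → ArcSet n → ℕ
#spokes S = ∣ tabulate (S ∘ spoke) ∣

-- Two angulations are equal when they contain the same arcs.
Angulations : (m n s : ℕ) → Setoid 0ℓ 0ℓ
Angulations m n s = On.setoid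
  {B = Σ[ S ∈ ArcSet n ] (IsAngulation m S × #spokes S ≡ s)}
  (Arc n →-setoid Bool) proj₁

HasCardinality : Setoid 0ℓ 0ℓ → ℕ → Set
HasCardinality A N = Inverse A (setoid (Fin N))

{-# OPTIONS --safe #-}

-- Extend c a, the number of chords that start at v_a, periodically to ℕ, and
-- let H a = m (c 0 + … + c (a - 1)) - a.  This is the walk that reads off, in
-- preorder, the trees dual to the polygons away from •.  In an angulation a
-- pair a < b is an edge iff b ≡ a + 1 mod m, H a ≤ H b + 1 and H b < H x
-- whenever a < x < b; and, with H extended to ℤ, a spoke ends at a iff a lies
-- in a fixed residue class mod m and H a < H x for all x < a.  So the angulation is determined by c
-- and the residue class.  Consecutive spokes p < q satisfy H q = H p - m,
-- hence H falls by m s per turn and c has sum ℓ - s.  Conversely, these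
-- conditions define an angulation for every residue class and every weak
-- composition c of ℓ - s into n parts, which gives m times the number of weak
-- compositions.
module Submission where

open import Data.Bool using (Bool; true; false; T)
open import Data.Bool.Properties using (T?)
open import Data.Fin using (Fin; toℕ; zero; suc; fromℕ<)
import Data.Fin.Properties as Fin
open import Data.Fin.Subset using (∣_∣)
open import Data.Integer as ℤ using (ℤ; +_; 1ℤ) renaming (suc to sucℤ)
import Data.Integer.Properties as ℤ
open import Data.Integer.Tactic.RingSolver using (solve-∀)
open import Data.Nat
open import Data.Nat.Combinatorics using (_C_; nCk+nC[k+1]≡[n+1]C[k+1]; nCn≡1)
open import Data.Nat.DivMod
open import Data.Nat.Divisibility
open import Data.Nat.Induction using (<-rec)
open import Data.Nat.Properties
import Data.Nat.Tactic.RingSolver as ℕS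
open import Data.Product
open import Data.Product.Algebra using (×-comm)
open import Data.Product.Function.NonDependent.Propositional using (_×-↔_)
import Data.Sum
open import Data.Sum using (_⊎_; inj₁; inj₂)
open import Data.Sum.Function.Propositional using (_⊎-↔_)
open import Data.Vec using (Vec; []; _∷_; lookup; tabulate; sum)
import Data.Vec.Properties as Vec
open import Function
import Function.Construct.Composition as Compose
open import Function.Properties.Inverse using (↔-refl; ↔-sym; ↔-trans)
open import Relation.Binary using (Setoid)
open import Relation.Binary.Construct.Add.Supremum.Strict _<_
  using ([_]; [_]<⊤⁺; <⁺-trans; <⁺-irrefl-≡; <⁺-cmp-≡; [<]-injective)
open import Relation.Binary.Definitions using (tri<; tri≈; tri>)
open import Relation.Binary.PropositionalEquality
open import Relation.Nullary
open import Relation.Nullary.Decidable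
open import Relation.Unary using (Decidable)
open import Defs

-- The edge criterion is not proved for an arbitrary angulation. There it is enough to know
-- (`edge-law`) that the k-th chord at `a`, counted from the shortest, ends at the first point after
-- `a` whose height is m k below that of a + 1. Two angulations with the same counts then have the
-- same chords. In the converse direction the criterion is the definition of the set, and the work
-- lies in showing that all its polygons have the right size and that `v_a` starts neither too many
-- nor too few chords. Both directions share `euler`, n = m (chords + spokes). It gives the sum of c
-- for a given angulation; for a constructed one, whose chord counts are recovered first, it gives
-- the number of spokes, which is never counted directly. The construction depends on the walk
-- falling by at most 1 per step, so that it meets every level through which it descends. The points
-- of the cover are natural numbers. A condition on all earlier points is therefore replaced by its
-- translate within the next turn, and arguments that look to the left begin by translating to the
-- right.

Σ< : (ℕ → ℕ) → ℕ → ℕ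
Σ< f zero    = 0
Σ< f (suc a) = Σ< f a + f a

Σ<-cong : ∀ {f g} → (∀ a → f a ≡ g a) → ∀ a → Σ< f a ≡ Σ< g a
Σ<-cong f≗g zero    = refl
Σ<-cong f≗g (suc a) = cong₂ _+_ (Σ<-cong f≗g a) (f≗g a)

Σ<-suc : ∀ f n → Σ< f (suc n) ≡ f 0 + Σ< (f ∘ suc) n
Σ<-suc f zero    = sym (+-identityʳ (f 0))
Σ<-suc f (suc n) = trans (cong (_+ f (suc n)) (Σ<-suc f n)) (+-assoc (f 0) _ _)

Σ<-periodic : ∀ f n → (∀ a → f (a + n) ≡ f a) → ∀ a → Σ< f (a + n) ≡ Σ< f a + Σ< f n
Σ<-periodic f n per zero    = refl
Σ<-periodic f n per (suc a) = trans
  (cong₂ _+_ (Σ<-periodic f n per a) (per a))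
  (ex (Σ< f a) (Σ< f n) (f a))
  where
  ex : ∀ x y z → x + y + z ≡ x + z + y
  ex = ℕS.solve-∀

Σ<-const : ∀ f {a b} → a ≤ b → (∀ x → a ≤ x → x < b → f x ≡ 0) → Σ< f b ≡ Σ< f a
Σ<-const f {a} {b} a≤b f≡0 with ≤⇒≤′ a≤b
... | ≤′-refl = refl
... | ≤′-step {b′} a≤′b′ = trans
  (cong₂ _+_ (Σ<-const f (≤′⇒≤ a≤′b′) (λ x a≤x x<b′ → f≡0 x a≤x (m<n⇒m<1+n x<b′)))
             (f≡0 b′ (≤′⇒≤ a≤′b′) ≤-refl))
  (+-identityʳ _)

Σ<-mono : ∀ f {a b} → a ≤ b → Σ< f a ≤ Σ< f b
Σ<-mono f {a} {b} a≤b with ≤⇒≤′ a≤b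
... | ≤′-refl = ≤-refl
... | ≤′-step {b′} a≤′b′ = ≤-trans (Σ<-mono f (≤′⇒≤ a≤′b′)) (m≤m+n _ _)

bit : Bool → ℕ
bit true  = 1
bit false = 0

bit-T : ∀ {b} → T b → bit b ≡ 1
bit-T {true} _ = refl

bit-¬T : ∀ {b} → ¬ T b → bit b ≡ 0
bit-¬T {true}  ¬t = contradiction _ ¬t
bit-¬T {false} _  = refl

sum≡Σ< : ∀ {n} (c : Vec ℕ n) f → (∀ i → f (toℕ i) ≡ lookup c i) → sum c ≡ Σ< f n
sum≡Σ< []      f eq = refl
sum≡Σ< {suc n} (x ∷ c) f eq = trans
  (cong₂ _+_ (sym (eq zero)) (sum≡Σ< c (f ∘ suc) (eq ∘ suc))) (sym (Σ<-suc f n))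

card≡Σ< : ∀ {n} (b : Fin n → Bool) f → (∀ i → f (toℕ i) ≡ bit (b i)) →
          ∣ tabulate b ∣ ≡ Σ< f n
card≡Σ< {zero}  b f eq = refl
card≡Σ< {suc n} b f eq = trans (head (b zero) (sym (eq zero))) (sym (Σ<-suc f n))
  where
  tail = card≡Σ< (b ∘ suc) (f ∘ suc) (eq ∘ suc)
  head : ∀ x → bit x ≡ f 0 → ∣ x ∷ tabulate (b ∘ suc) ∣ ≡ f 0 + Σ< (f ∘ suc) n
  head true  e = cong₂ _+_ e tail
  head false e = cong₂ _+_ e tail

largest : ∀ {p} {P : ℕ → Set p} → Decidable P → ∀ {x B} → x ≤ B → P x →
          ∃[ y ] x ≤ y × y ≤ B × P y × (∀ {z} → y < z → z ≤ B → ¬ P z)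
largest P? {x} {B} x≤B px with P? B
... | yes pB = B , x≤B , ≤-refl , pB , λ B<z z≤B → contradiction (<-≤-trans B<z z≤B) (<-irrefl refl)
... | no ¬pB with ≤⇒≤′ x≤B
...   | ≤′-refl = contradiction px ¬pB
...   | ≤′-step {B′} x≤′B′ with largest P? (≤′⇒≤ x≤′B′) px
...     | y , x≤y , y≤B′ , py , max = y , x≤y , m≤n⇒m≤1+n y≤B′ , py , max′
  where
  max′ : ∀ {z} → y < z → z ≤ suc B′ → ¬ _
  max′ y<z z≤B pz with m≤n⇒m<n∨m≡n z≤B
  ... | inj₁ z<B  = max y<z (s≤s⁻¹ z<B) pz
  ... | inj₂ refl = ¬pB pz

-- Integer inequalities, residues and height differences

infix 4 _⋖_
-- The strict order is written through ≤, so that the same monotonicity and cancellation rules serve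
-- both orders.
_⋖_ : ℤ → ℤ → Set
i ⋖ j = sucℤ i ℤ.≤ j

⋖⇒≤ : ∀ {i j} → i ⋖ j → i ℤ.≤ j
⋖⇒≤ = ℤ.≤-trans (ℤ.i≤suc[i] _)

⋖-irrefl : ∀ {i} → ¬ i ⋖ i
⋖-irrefl p = ℤ.<-irrefl refl (ℤ.suc[i]≤j⇒i<j p)

⋖⇒≱ : ∀ {i j} → i ⋖ j → ¬ j ℤ.≤ i
⋖⇒≱ p q = ⋖-irrefl (ℤ.≤-trans p q)

≰⇒⋗ : ∀ {i j} → ¬ i ℤ.≤ j → j ⋖ i
≰⇒⋗ p = ℤ.i<j⇒suc[i]≤j (ℤ.≰⇒> p)

suc-≤ : ∀ {i j} → i ℤ.≤ j → sucℤ i ℤ.≤ sucℤ j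
suc-≤ = ℤ.+-monoʳ-≤ 1ℤ

+-cancelˡ-≤ℤ : ∀ k {i j} → k ℤ.+ i ℤ.≤ k ℤ.+ j → i ℤ.≤ j
+-cancelˡ-≤ℤ k {i} {j} p = subst₂ ℤ._≤_ (ex k i) (ex k j) (ℤ.+-monoʳ-≤ (ℤ.- k) p)
  where
  ex : ∀ k x → ℤ.- k ℤ.+ (k ℤ.+ x) ≡ x
  ex = solve-∀

+-cancelˡ-≡ℤ : ∀ k {i j} → k ℤ.+ i ≡ k ℤ.+ j → i ≡ j
+-cancelˡ-≡ℤ k e = ℤ.≤-antisym (+-cancelˡ-≤ℤ k (ℤ.≤-reflexive e)) (+-cancelˡ-≤ℤ k (ℤ.≤-reflexive (sym e)))

suc-≤⁻¹ : ∀ {i j} → sucℤ i ℤ.≤ sucℤ j → i ℤ.≤ j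
suc-≤⁻¹ = +-cancelˡ-≤ℤ 1ℤ

toℕ-mod : ∀ a n .{{_ : NonZero n}} → toℕ (a mod n) ≡ a % n
toℕ-mod a (suc n) = Fin.toℕ-fromℕ< (m%n<n a (suc n))

%≡⇒mod≡ : ∀ {a b n} .{{_ : NonZero n}} → a % n ≡ b % n → a mod n ≡ b mod n
%≡⇒mod≡ {a} {b} {n} e = Fin.toℕ-injective (trans (toℕ-mod a n) (trans e (sym (toℕ-mod b n))))

toℕ+kn-mod : ∀ {n} .{{_ : NonZero n}} (i : Fin n) t → (toℕ i + t * n) mod n ≡ i
toℕ+kn-mod {n} i t = Fin.toℕ-injective (trans (toℕ-mod (toℕ i + t * n) n)
  (trans ([m+kn]%n≡m%n (toℕ i) t n) (m<n⇒m%n≡m (Fin.toℕ<n i))))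

toℕ-mod-id : ∀ {n} .{{_ : NonZero n}} (i : Fin n) → toℕ i mod n ≡ i
toℕ-mod-id {n} i = trans (cong (_mod n) (sym (+-identityʳ (toℕ i)))) (toℕ+kn-mod i 0)

minus-plus : ∀ x y → x ℤ.- y ℤ.+ y ≡ x
minus-plus = solve-∀

height-suc : ∀ {h h′ : ℤ} {a A A′ k : ℕ} → h ℤ.+ + a ≡ + A → h′ ℤ.+ + suc a ≡ + A′ → A′ ≡ A + k →
             sucℤ h′ ≡ h ℤ.+ + k
height-suc {h} {h′} {a} {A} {A′} {k} e e′ A′≡ = +-cancelˡ-≡ℤ (+ a) (begin
  + a ℤ.+ (1ℤ ℤ.+ h′)       ≡⟨ ex₁ (+ a) h′ ⟩
  h′ ℤ.+ (1ℤ ℤ.+ + a)       ≡⟨ trans e′ (trans (cong +_ A′≡) (ℤ.pos-+ A k)) ⟩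
  + A ℤ.+ + k               ≡⟨ cong (λ z → z ℤ.+ + k) (sym e) ⟩
  h ℤ.+ + a ℤ.+ + k         ≡⟨ ex₂ (+ a) h (+ k) ⟩
  + a ℤ.+ (h ℤ.+ + k)       ∎)
  where
  open ≡-Reasoning
  ex₁ : ∀ x y → x ℤ.+ (1ℤ ℤ.+ y) ≡ y ℤ.+ (1ℤ ℤ.+ x)
  ex₁ = solve-∀
  ex₂ : ∀ x y z → y ℤ.+ x ℤ.+ z ≡ x ℤ.+ (y ℤ.+ z)
  ex₂ = solve-∀

-- The heights are known through h + a = A and h′ + b = B. This removes the subtraction and turns a
-- drop into an equation in ℕ, which can be reduced mod m.
height-drop⇒ : ∀ {h h′ : ℤ} {a b A B r : ℕ} → h ℤ.+ + a ≡ + A → h′ ℤ.+ + b ≡ + B →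
               h ≡ + r ℤ.+ h′ → A + b ≡ r + B + a
height-drop⇒ {h} {h′} {a} {b} {A} {B} {r} e e′ d = ℤ.+-injective (begin
  + (A + b)                         ≡⟨ ℤ.pos-+ A b ⟩
  + A ℤ.+ + b                       ≡⟨ cong (λ z → z ℤ.+ + b) (trans (sym e) (cong (λ z → z ℤ.+ + a) d)) ⟩
  + r ℤ.+ h′ ℤ.+ + a ℤ.+ + b        ≡⟨ ex (+ r) h′ (+ a) (+ b) ⟩
  + r ℤ.+ (h′ ℤ.+ + b) ℤ.+ + a      ≡⟨ cong (λ z → + r ℤ.+ z ℤ.+ + a) e′ ⟩
  + r ℤ.+ + B ℤ.+ + a               ≡⟨ cong (λ z → z ℤ.+ + a) (sym (ℤ.pos-+ r B)) ⟩
  + (r + B) ℤ.+ + a                 ≡⟨ sym (ℤ.pos-+ (r + B) a) ⟩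
  + (r + B + a)                     ∎)
  where
  open ≡-Reasoning
  ex : ∀ r x y z → r ℤ.+ x ℤ.+ y ℤ.+ z ≡ r ℤ.+ (x ℤ.+ z) ℤ.+ y
  ex = solve-∀

height-drop⇐ : ∀ {h h′ : ℤ} {a b A B r : ℕ} → h ℤ.+ + a ≡ + A → h′ ℤ.+ + b ≡ + B →
               A + b ≡ r + B + a → h ≡ + r ℤ.+ h′
height-drop⇐ {h} {h′} {a} {b} {A} {B} {r} e e′ d = +-cancelˡ-≡ℤ (+ a ℤ.+ + b) (begin
  + a ℤ.+ + b ℤ.+ h                 ≡⟨ ex₁ (+ a) (+ b) h ⟩
  h ℤ.+ + a ℤ.+ + b                 ≡⟨ cong (λ z → z ℤ.+ + b) e ⟩
  + A ℤ.+ + b                       ≡⟨ trans (sym (ℤ.pos-+ A b)) (trans (cong +_ d) (ℤ.pos-+ (r + B) a)) ⟩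
  + (r + B) ℤ.+ + a                 ≡⟨ cong (λ z → z ℤ.+ + a) (ℤ.pos-+ r B) ⟩
  + r ℤ.+ + B ℤ.+ + a               ≡⟨ cong (λ z → + r ℤ.+ z ℤ.+ + a) (sym e′) ⟩
  + r ℤ.+ (h′ ℤ.+ + b) ℤ.+ + a      ≡⟨ ex₂ (+ r) h′ (+ a) (+ b) ⟩
  + a ℤ.+ + b ℤ.+ (+ r ℤ.+ h′)      ∎)
  where
  open ≡-Reasoning
  ex₁ : ∀ x y z → x ℤ.+ y ℤ.+ z ≡ z ℤ.+ x ℤ.+ y
  ex₁ = solve-∀
  ex₂ : ∀ r x y z → r ℤ.+ (x ℤ.+ z) ℤ.+ y ≡ y ℤ.+ z ℤ.+ (r ℤ.+ x)
  ex₂ = solve-∀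

-- The height walk of a vector of chord counts

module Heights (m : ℕ) .{{_ : NonZero m}} {N : ℕ} (c : Vec ℕ (suc N)) where

  private n = suc N

  starts : ℕ → ℕ
  starts a = lookup c (a mod n)

  -- Opaque, because unification would otherwise lose a in H a.
  opaque
    H : ℕ → ℤ
    H a = + (m * Σ< starts a) ℤ.- + a

    H-def : ∀ a → H a ℤ.+ + a ≡ + (m * Σ< starts a)
    H-def a = minus-plus (+ (m * Σ< starts a)) (+ a)

  infix 4 _≅_
  _≅_ : ℕ → ℕ → Set
  a ≅ b = a % m ≡ b % m

  Low : ℕ → ℕ → Set
  Low a b = ∀ x → x < b → a < x → H b ⋖ H x

  infix 4 _↘[_]_
  -- For a < b and r ≥ 1 this says that `b` is the first point after `a` at height H a - r.
  record _↘[_]_ (a r b : ℕ) : Set where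
    field
      drop : H a ≡ + r ℤ.+ H b
      low  : Low a b
  open _↘[_]_ public

  -- The edges [ a ] [ b ], read off from the heights.
  record Admissible (a b : ℕ) : Set where
    field
      ordered : a < b
      residue : suc a ≅ b
      shallow : H a ℤ.≤ sucℤ (H b)
      deep    : Low a b
  open Admissible public

  starts-mod : ∀ a → starts (a + n) ≡ starts a
  starts-mod a = cong (lookup c) (%≡⇒mod≡ {a + n} {a} ([m+n]%n≡m%n a n))

  H-suc : ∀ a → sucℤ (H (suc a)) ≡ H a ℤ.+ + (m * starts a)
  H-suc a = height-suc {H a} {H (suc a)} {a} (H-def a) (H-def (suc a)) (*-distribˡ-+ m (Σ< starts a) (starts a))

  H-step : ∀ a → H a ℤ.≤ sucℤ (H (suc a))
  H-step a = ℤ.≤-trans (ℤ.i≤i+j (H a) (+ (m * starts a))) (ℤ.≤-reflexive (sym (H-suc a)))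

  drop⇒ : ∀ {a b r} → H a ≡ + r ℤ.+ H b → m * Σ< starts a + b ≡ r + m * Σ< starts b + a
  drop⇒ {a} {b} = height-drop⇒ {H a} {H b} (H-def a) (H-def b)

  drop⇐ : ∀ {a b r} → m * Σ< starts a + b ≡ r + m * Σ< starts b + a → H a ≡ + r ℤ.+ H b
  drop⇐ {a} {b} = height-drop⇐ {H a} {H b} (H-def a) (H-def b)

  -- The chords contribute multiples of m, so H a is congruent to -a mod m.
  drop⇒≅ : ∀ {a b} k → H a ≡ + (m * k) ℤ.+ H b → a ≅ b
  drop⇒≅ {a} {b} k e = sym (begin
    b % m                                   ≡⟨ sym (%-remove-+ˡ b (m∣m*n (Σ< starts a))) ⟩
    (m * Σ< starts a + b) % m               ≡⟨ %-congˡ (drop⇒ {a} {b} e) ⟩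
    (m * k + m * Σ< starts b + a) % m       ≡⟨ %-remove-+ˡ a (∣m∣n⇒∣m+n (m∣m*n k) (m∣m*n (Σ< starts b))) ⟩
    a % m                                   ∎)
    where open ≡-Reasoning

  private
    %≡⇒∣ : ∀ {r a} → a % m ≡ (r + a) % m → m ∣ r
    %≡⇒∣ {r} {a} e = ∣m+n∣m⇒∣n
      (subst (m ∣_) (sym (trans (+-comm (a / m * m) r) quotients)) (n∣m*n ((r + a) / m)))
      (n∣m*n (a / m))
      where
      open ≡-Reasoning
      quotients : r + a / m * m ≡ (r + a) / m * m
      quotients = +-cancelˡ-≡ (a % m) _ _ (begin
        a % m + (r + a / m * m)           ≡⟨ ex (a % m) r (a / m * m) ⟩
        r + (a % m + a / m * m)           ≡⟨ cong (_+_ r) (sym (m≡m%n+[m/n]*n a m)) ⟩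
        r + a                             ≡⟨ m≡m%n+[m/n]*n (r + a) m ⟩
        (r + a) % m + (r + a) / m * m     ≡⟨ cong (_+ (r + a) / m * m) (sym e) ⟩
        a % m + (r + a) / m * m           ∎)
        where
        ex : ∀ x y z → x + (y + z) ≡ y + (x + z)
        ex = ℕS.solve-∀

  drop⇒∣ : ∀ {a b r} → a ≅ b → H a ≡ + r ℤ.+ H b → m ∣ r
  drop⇒∣ {a} {b} {r} a≅b e = %≡⇒∣ {r} {a} (begin
    a % m                                   ≡⟨ a≅b ⟩
    b % m                                   ≡⟨ sym (%-remove-+ˡ b (m∣m*n (Σ< starts a))) ⟩
    (m * Σ< starts a + b) % m               ≡⟨ %-congˡ (drop⇒ {a} {b} e) ⟩
    (r + m * Σ< starts b + a) % m           ≡⟨ %-congˡ (ex r (m * Σ< starts b) a) ⟩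
    (m * Σ< starts b + (r + a)) % m         ≡⟨ %-remove-+ˡ (r + a) (m∣m*n (Σ< starts b)) ⟩
    (r + a) % m                             ∎)
    where
    open ≡-Reasoning
    ex : ∀ x y z → x + y + z ≡ y + (x + z)
    ex = ℕS.solve-∀

  -- A discrete intermediate value theorem: by `H-step` the walk cannot jump over the level h on its
  -- way down. The point `b` is the first hit.
  hit : ∀ h k x → h ℤ.≤ H x → H (k + x) ℤ.≤ h →
        ∃[ b ] x ≤ b × b ≤ k + x × H b ≡ h × (∀ {z} → x ≤ z → z < b → h ⋖ H z)
  hit h zero x h≤ ≤h = x , ≤-refl , ≤-refl , ℤ.≤-antisym ≤h h≤ ,
    λ x≤z z<x → contradiction (≤-<-trans x≤z z<x) (<-irrefl refl)
  hit h (suc k) x h≤ ≤h with H x ℤ.≤? h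
  ... | yes x≤h = x , ≤-refl , m≤n+m x (suc k) , ℤ.≤-antisym x≤h h≤ ,
    λ x≤z z<x → contradiction (≤-<-trans x≤z z<x) (<-irrefl refl)
  ... | no x≰h with hit h k (suc x) (suc-≤⁻¹ (ℤ.≤-trans (≰⇒⋗ x≰h) (H-step x)))
                      (subst (λ z → H z ℤ.≤ h) (sym (+-suc k x)) ≤h)
  ...   | b , x<b , b≤ , Hb , above = b , <⇒≤ x<b , ≤-trans b≤ (≤-reflexive (+-suc k x)) , Hb , above′
    where
    above′ : ∀ {z} → x ≤ z → z < b → h ⋖ H z
    above′ x≤z z<b with m≤n⇒m<n∨m≡n x≤z
    ... | inj₁ x<z  = above x<z z<b
    ... | inj₂ refl = ≰⇒⋗ x≰h

  Low-trans : ∀ {a x b} → H b ⋖ H x → Low a x → Low x b → Low a b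
  Low-trans {a} {x} Hb⋖Hx low₁ low₂ y y<b a<y with <-cmp y x
  ... | tri< y<x _ _ = ℤ.≤-trans Hb⋖Hx (⋖⇒≤ (low₁ y y<x a<y))
  ... | tri≈ _ refl _ = Hb⋖Hx
  ... | tri> _ _ x<y = low₂ y y<b x<y

  ↘-refl : ∀ {a} → a ↘[ 0 ] a
  ↘-refl .drop = sym (ℤ.+-identityˡ _)
  ↘-refl .low y y<a a<y = contradiction (<-trans y<a a<y) (<-irrefl refl)

  ↘-⋖ : ∀ {a r b} → a ↘[ suc r ] b → H b ⋖ H a
  ↘-⋖ {a} {r} {b} d = ℤ.≤-trans (suc-≤ (ℤ.i≤j+i (H b) (+ r)))
    (ℤ.≤-reflexive (trans (sym (ℤ.+-assoc 1ℤ (+ r) (H b))) (sym (d .drop))))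

  ↘-trans : ∀ {a r x r′ b} → a ↘[ r ] x → x ↘[ suc r′ ] b → a ↘[ r + suc r′ ] b
  ↘-trans {a} {r} {x} {r′} {b} d e .drop = trans (d .drop) (trans (cong (ℤ._+_ (+ r)) (e .drop))
    (trans (sym (ℤ.+-assoc (+ r) (+ suc r′) (H b))) (cong (ℤ._+ H b) (sym (ℤ.pos-+ r (suc r′))))))
  ↘-trans d e .low = Low-trans (↘-⋖ e) (d .low) (e .low)

  -- Each of the two is the first point after `a` at its height.
  Low-unique : ∀ {a b b′} → H b ≡ H b′ → Low a b → Low a b′ → a < b → a < b′ → b ≡ b′
  Low-unique {b = b} {b′} e low low′ a<b a<b′ with <-cmp b b′
  ... | tri< b<b′ _ _ = contradiction (low′ b b<b′ a<b) (λ p → ⋖⇒≱ p (ℤ.≤-reflexive e))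
  ... | tri≈ _ b≡b′ _ = b≡b′
  ... | tri> _ _ b′<b = contradiction (low b′ b′<b a<b′) (λ p → ⋖⇒≱ p (ℤ.≤-reflexive (sym e)))

  Low? : ∀ a b → Dec (Low a b)
  Low? a b = map′ (λ f x → f {x}) (λ f {x} → f x) (allUpTo? (λ x → (a <? x) →-dec (sucℤ (H b) ℤ.≤? H x)) b)

  admissible? : ∀ a b → Dec (Admissible a b)
  admissible? a b = map′
    (λ (p , q , r , s) → record { ordered = p ; residue = q ; shallow = r ; deep = s })
    (λ adm → adm .ordered , adm .residue , adm .shallow , adm .deep)
    ((a <? b) ×-dec (suc a % m ≟ b % m) ×-dec (H a ℤ.≤? sucℤ (H b)) ×-dec Low? a b)

  Σ<-starts-shift : ∀ a → Σ< starts (a + n) ≡ Σ< starts a + sum c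
  Σ<-starts-shift a = trans (Σ<-periodic starts n starts-mod a)
    (cong (_+_ (Σ< starts a)) (sym (sum≡Σ< c starts λ i →
      cong (lookup c) (toℕ-mod-id i))))

  module Periodicity {δ : ℕ} (n≡ : n ≡ m * sum c + δ) where

    -- One turn passes every start once, which adds m * sum c, and makes n steps, which subtracts n.
    H-shift : ∀ a → H a ≡ + δ ℤ.+ H (a + n)
    H-shift a = drop⇐ (begin
      m * Σ< starts a + (a + n)                   ≡⟨ cong (λ z → m * Σ< starts a + (a + z)) n≡ ⟩
      m * Σ< starts a + (a + (m * sum c + δ))     ≡⟨ ex m (Σ< starts a) (sum c) a δ ⟩
      δ + m * (Σ< starts a + sum c) + a           ≡⟨ cong (λ z → δ + m * z + a) (sym (Σ<-starts-shift a)) ⟩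
      δ + m * Σ< starts (a + n) + a               ∎)
      where
      open ≡-Reasoning
      ex : ∀ m g s a δ → m * g + (a + (m * s + δ)) ≡ δ + m * (g + s) + a
      ex = ℕS.solve-∀

    H-shift* : ∀ a t → H a ≡ + (t * δ) ℤ.+ H (a + t * n)
    H-shift* a zero = sym (trans (ℤ.+-identityˡ _) (cong H (+-identityʳ a)))
    H-shift* a (suc t) = begin
      H a                                                 ≡⟨ H-shift* a t ⟩
      + (t * δ) ℤ.+ H (a + t * n)                         ≡⟨ cong (ℤ._+_ (+ (t * δ))) (H-shift (a + t * n)) ⟩
      + (t * δ) ℤ.+ (+ δ ℤ.+ H (a + t * n + n))           ≡⟨ sym (ℤ.+-assoc (+ (t * δ)) (+ δ) (H (a + t * n + n))) ⟩
      + (t * δ) ℤ.+ + δ ℤ.+ H (a + t * n + n)             ≡⟨ cong₂ ℤ._+_ (trans (sym (ℤ.pos-+ (t * δ) δ))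
                                                                            (cong +_ (+-comm (t * δ) δ)))
                                                               (cong H (trans (+-assoc a (t * n) n) (cong (_+_ a) (+-comm (t * n) n)))) ⟩
      + (δ + t * δ) ℤ.+ H (a + (n + t * n))               ∎
      where open ≡-Reasoning

    sucH-shift* : ∀ a t → sucℤ (H a) ≡ + (t * δ) ℤ.+ sucℤ (H (a + t * n))
    sucH-shift* a t = trans (cong sucℤ (H-shift* a t)) (ex (+ (t * δ)) (H (a + t * n)))
      where
      ex : ∀ x y → 1ℤ ℤ.+ (x ℤ.+ y) ≡ x ℤ.+ (1ℤ ℤ.+ y)
      ex = solve-∀

    shift-⋖ : ∀ {a b} t → H a ⋖ H b → H (a + t * n) ⋖ H (b + t * n)
    shift-⋖ {a} {b} t p = +-cancelˡ-≤ℤ (+ (t * δ)) (subst₂ ℤ._≤_ (sucH-shift* a t) (H-shift* b t) p)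

    unshift-⋖ : ∀ {a b} t → H (a + t * n) ⋖ H (b + t * n) → H a ⋖ H b
    unshift-⋖ {a} {b} t p = subst₂ ℤ._≤_ (sym (sucH-shift* a t)) (sym (H-shift* b t)) (ℤ.+-monoʳ-≤ (+ (t * δ)) p)

    shift-Low : ∀ {a b} t → Low a b → Low (a + t * n) (b + t * n)
    shift-Low {a} {b} t low x x<b a<x with m≤n⇒∃[o]m+o≡n (≤-trans (m≤n+m (t * n) a) (<⇒≤ a<x))
    ... | o , refl = subst (λ z → H (b + t * n) ⋖ H z) (+-comm o (t * n))
      (shift-⋖ t (low o (+-cancelʳ-< (t * n) o b (subst (_< b + t * n) (+-comm (t * n) o) x<b))
                      (+-cancelʳ-< (t * n) a o (subst (a + t * n <_) (+-comm (t * n) o) a<x))))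

    unshift-Low : ∀ {a b} t → Low (a + t * n) (b + t * n) → Low a b
    unshift-Low t low x x<b a<x = unshift-⋖ t (low (x + t * n) (+-monoˡ-< (t * n) x<b) (+-monoˡ-< (t * n) a<x))

    module _ (m∣n : m ∣ n) where

      shift-≅ : ∀ a t → a + t * n ≅ a
      shift-≅ a t = %-remove-+ʳ a (∣n⇒∣m*n t m∣n)

      shift-Admissible : ∀ {a b} t → Admissible a b → Admissible (a + t * n) (b + t * n)
      shift-Admissible {a} {b} t adm = record
        { ordered = +-monoˡ-< (t * n) (adm .ordered)
        ; residue = trans (shift-≅ (suc a) t) (trans (adm .residue) (sym (shift-≅ b t)))
        ; shallow = +-cancelˡ-≤ℤ (+ (t * δ)) (subst₂ ℤ._≤_ (H-shift* a t) (sucH-shift* b t) (adm .shallow))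
        ; deep    = shift-Low t (adm .deep)
        }

      unshift-Admissible : ∀ {a b} t → Admissible (a + t * n) (b + t * n) → Admissible a b
      unshift-Admissible {a} {b} t adm = record
        { ordered = +-cancelʳ-< (t * n) a b (adm .ordered)
        ; residue = trans (sym (shift-≅ (suc a) t)) (trans (adm .residue) (shift-≅ b t))
        ; shallow = subst₂ ℤ._≤_ (sym (H-shift* a t)) (sym (sucH-shift* b t)) (ℤ.+-monoʳ-≤ (+ (t * δ)) (adm .shallow))
        ; deep    = unshift-Low t (adm .deep)
        }

-- Edges in the cover

<⁺-tr : ∀ {x y z} → x <⁺ y → y <⁺ z → x <⁺ z
<⁺-tr = <⁺-trans <-trans

<⁺-irr : ∀ {x} → ¬ x <⁺ x
<⁺-irr = <⁺-irrefl-≡ <-irrefl refl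

no-between : ∀ {a b} → ¬ (a < b × b < suc a)
no-between (a<b , b<1+a) = <-irrefl refl (<-≤-trans a<b (s≤s⁻¹ b<1+a))

lift-shift : ∀ a n .{{_ : NonZero n}} → toℕ (a mod n) + a / n * n ≡ a
lift-shift a n = trans (cong (_+ a / n * n) (toℕ-mod a n)) (sym (m≡m%n+[m/n]*n a n))

module Edges {N : ℕ} (S : ArcSet (suc N)) where

  private n = suc N

  -- Defined for all naturals, and false beyond the longest possible chord, so that the chords at a
  -- vertex can be counted by partial sums.
  chordAt : ℕ → ℕ → Bool
  chordAt a d with d <? N
  ... | yes d<N = S (chord (a mod n) (fromℕ< d<N))
  ... | no  _   = false

  spokeAt : ℕ → Bool
  spokeAt a = S (spoke (a mod n))

  chordAt-toℕ : ∀ a (d : Fin N) → chordAt a (toℕ d) ≡ S (chord (a mod n) d)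
  chordAt-toℕ a d with toℕ d <? N
  ... | yes d<N = cong (λ z → S (chord (a mod n) z)) (Fin.fromℕ<-toℕ d d<N)
  ... | no  d≮N = contradiction (Fin.toℕ<n d) d≮N

  chordAt-< : ∀ a d → T (chordAt a d) → d < N
  chordAt-< a d t with d <? N
  ... | yes d<N = d<N

  chordAt-mod : ∀ a b → a mod n ≡ b mod n → ∀ d → chordAt a d ≡ chordAt b d
  chordAt-mod a b e d with d <? N
  ... | yes d<N = cong (λ z → S (chord z (fromℕ< d<N))) e
  ... | no  _   = refl

  ChordEdge : ℕ → ℕ → Set
  ChordEdge a b = Edge S [ a ] [ b ]

  SpokeEdge : ℕ → Set
  SpokeEdge a = Edge S [ a ] ⊤⁺

  chord⇒edge : ∀ a d → T (chordAt a d) → ChordEdge a (a + suc (suc d))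
  chord⇒edge a d t = subst₂ (λ x y → ChordEdge x (x + suc (suc y)))
    (lift-shift a n) (Fin.toℕ-fromℕ< d<N)
    (arc (subst T (trans (cong (chordAt a) (sym (Fin.toℕ-fromℕ< d<N))) (chordAt-toℕ a (fromℕ< d<N))) t)
         (chord (a mod n) (fromℕ< d<N) (a / n)))
    where d<N = chordAt-< a d t

  edge⇒chord : ∀ {a b} → ChordEdge a b → b ≡ suc a ⊎ ∃[ d ] (b ≡ a + suc (suc d) × T (chordAt a d))
  edge⇒chord (boundary a) = inj₁ refl
  edge⇒chord (arc α∈S (chord i d t)) = inj₂ (toℕ d , refl , subst T
    (sym (trans (chordAt-toℕ _ d) (cong (λ z → S (chord z d)) (toℕ+kn-mod i t)))) α∈S)

  edge⇒chordAt : ∀ {a d} → ChordEdge a (a + suc (suc d)) → T (chordAt a d)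
  edge⇒chordAt {a} {d} e with edge⇒chord e
  ... | inj₁ eq = contradiction (+-cancelˡ-≡ a _ _ (trans eq (+-comm 1 a))) λ ()
  ... | inj₂ (d′ , eq , t) with +-cancelˡ-≡ a _ _ eq
  ...   | refl = t

  spoke⇒edge : ∀ a → T (spokeAt a) → SpokeEdge a
  spoke⇒edge a t = subst SpokeEdge (lift-shift a n) (arc t (spoke (a mod n) (a / n)))

  edge⇒spoke : ∀ {a} → SpokeEdge a → T (spokeAt a)
  edge⇒spoke (arc α∈S (spoke i t)) = subst (λ z → T (S (spoke z))) (sym (toℕ+kn-mod i t)) α∈S

  edge-increasing : ∀ {x y} → Edge S x y → x <⁺ y
  edge-increasing (boundary a) = [ ≤-refl ]
  edge-increasing (arc _ (chord i d t)) = [ m<m+n _ z<s ]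
  edge-increasing (arc _ (spoke i t)) = [ _ ]<⊤⁺

  edge-< : ∀ {a b} → ChordEdge a b → a < b
  edge-< = [<]-injective ∘ edge-increasing

  edge-≤ : ∀ {a b} → ChordEdge a b → b ≤ a + n
  edge-≤ {a} e with edge⇒chord e
  ... | inj₁ refl = ≤-trans (≤-reflexive (+-comm 1 a)) (+-monoʳ-≤ a (s≤s z≤n))
  ... | inj₂ (d , refl , t) = +-monoʳ-≤ a (s≤s (chordAt-< a d t))

  chordEdge? : ∀ a b → Dec (ChordEdge a b)
  chordEdge? a b with b ≤? a
  ... | yes b≤a = no λ e → <-irrefl refl (<-≤-trans (edge-< e) b≤a)
  ... | no b≰a with m≤n⇒∃[o]m+o≡n (≰⇒> b≰a)
  ...   | zero  , refl = yes (subst (ChordEdge a) (sym (+-identityʳ (suc a))) (boundary a))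
  ...   | suc d , refl = map′
    (λ t → subst (ChordEdge a) (+-suc a (suc d)) (chord⇒edge a d t))
    (λ e → edge⇒chordAt (subst (ChordEdge a) (sym (+-suc a (suc d))) e))
    (T? (chordAt a d))

  spokeEdge? : ∀ a → Dec (SpokeEdge a)
  spokeEdge? a = map′ (spoke⇒edge a) edge⇒spoke (T? (spokeAt a))

  spokeEdge-mod : ∀ {a b} → a % n ≡ b % n → SpokeEdge a → SpokeEdge b
  spokeEdge-mod {a} {b} e p = spoke⇒edge b (subst (λ z → T (S (spoke z))) (%≡⇒mod≡ {a} {b} e) (edge⇒spoke p))

  spokeEdge-shift : ∀ {a} t → SpokeEdge a → SpokeEdge (a + t * n)
  spokeEdge-shift {a} t = spokeEdge-mod (sym ([m+kn]%n≡m%n a t n))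

  -- Boundary segments cross nothing, because no integer lies strictly between a and a + 1.
  edges-noncrossing : NonCrossing S → ∀ {x y z w} → Edge S x y → Edge S z w →
                      ¬ Interleaved x y z w
  edges-noncrossing nc (boundary a) _ ([ a<z ] , [ z<1+a ] , _) = no-between (a<z , z<1+a)
  edges-noncrossing nc (arc _ _) (boundary a) (_ , [ z<b ] , [ b<1+z ]) = no-between (z<b , b<1+z)
  edges-noncrossing nc (arc α∈S p) (arc β∈S q) il = nc _ _ α∈S β∈S (_ , _ , _ , _ , p , q , inj₁ il)

-- The corners are v 0 , … , v (suc r), so there are r + 2 of them.
record Polygon {N : ℕ} (S : ArcSet (suc N)) (r : ℕ) (v : ℕ → ℕ ⁺) : Set where
  field
    nonempty    : 1 ≤ r
    side        : ∀ i → i ≤ r → Edge S (v i) (v (suc i))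
    base        : Edge S (v 0) (v (suc r))
    no-diagonal : ∀ {i j} → suc i < j → j ≤ suc r → Edge S (v i) (v j) → i ≡ 0 × j ≡ suc r

-- Polygons and the edges that leave their corners

module Polygons {N : ℕ} (S : ArcSet (suc N)) where
  open Edges S

  module _ {r : ℕ} {v : ℕ → ℕ ⁺} (side : ∀ i → i ≤ r → Edge S (v i) (v (suc i))) where

    corner-mono : ∀ {i j} → i < j → j ≤ suc r → v i <⁺ v j
    corner-mono {i} {suc j} i<1+j 1+j≤1+r with m≤n⇒m<n∨m≡n (s≤s⁻¹ i<1+j)
    ... | inj₁ i<j  = <⁺-tr (corner-mono i<j (m≤n⇒m≤1+n (s≤s⁻¹ 1+j≤1+r))) (edge-increasing (side j (s≤s⁻¹ 1+j≤1+r)))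
    ... | inj₂ refl = edge-increasing (side j (s≤s⁻¹ 1+j≤1+r))

    locate : ∀ {i w} j → i < j → j ≤ suc r → v i <⁺ w → w <⁺ v j ⊎ w ≡ v j →
             ∃[ j′ ] i ≤ j′ × j′ < j × v j′ <⁺ w × (w <⁺ v (suc j′) ⊎ w ≡ v (suc j′))
    locate {i} {w} (suc j) i<1+j 1+j≤1+r vi<w w≤ with <⁺-cmp-≡ <-cmp (v j) w
    ... | tri< vj<w _ _ = j , s≤s⁻¹ i<1+j , ≤-refl , vj<w , w≤
    ... | tri≈ _ vj≡w _ with m≤n⇒m<n∨m≡n (s≤s⁻¹ i<1+j)
    ...   | inj₂ refl = contradiction (subst (v i <⁺_) (sym vj≡w) vi<w) <⁺-irr
    ...   | inj₁ i<j with locate j i<j (m≤n⇒m≤1+n (s≤s⁻¹ 1+j≤1+r)) vi<w (inj₂ (sym vj≡w))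
    ...     | j′ , i≤j′ , j′<j , rest = j′ , i≤j′ , m<n⇒m<1+n j′<j , rest
    locate {i} {w} (suc j) i<1+j 1+j≤1+r vi<w w≤ | tri> _ _ w<vj with m≤n⇒m<n∨m≡n (s≤s⁻¹ i<1+j)
    ...   | inj₂ refl = contradiction (<⁺-tr vi<w w<vj) <⁺-irr
    ...   | inj₁ i<j with locate j i<j (m≤n⇒m≤1+n (s≤s⁻¹ 1+j≤1+r)) vi<w (inj₁ w<vj)
    ...     | j′ , i≤j′ , j′<j , rest = j′ , i≤j′ , m<n⇒m<1+n j′<j , rest

  polygon⇒component : ∀ {r v} → Polygon S r v → PolygonalComponent S (suc (suc r))
  polygon⇒component {r} {v} pg = record
    { 3≤k        = s≤s (s≤s nonempty)
    ; corner     = v ∘ toℕ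
    ; increasing = λ {i} {j} i<j → corner-mono side i<j (s≤s⁻¹ (Fin.toℕ<n j))
    ; edges      = λ {i} {j} i<j → mk⇔ (to i j i<j) (from i j)
    }
    where
    open Polygon pg
    to : ∀ (i j : Fin (suc (suc r))) → toℕ i < toℕ j → Edge S (v (toℕ i)) (v (toℕ j)) → Adjacent i j
    to i j i<j e with m≤n⇒m<n∨m≡n i<j
    ... | inj₂ eq = inj₁ (sym eq)
    ... | inj₁ 1+i<j = inj₂ (map₂ (cong suc) (no-diagonal 1+i<j (s≤s⁻¹ (Fin.toℕ<n j)) e))
    from : ∀ (i j : Fin (suc (suc r))) → Adjacent i j → Edge S (v (toℕ i)) (v (toℕ j))
    from i j (inj₁ j≡1+i) = subst (λ z → Edge S (v (toℕ i)) (v z)) (sym j≡1+i)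
      (side (toℕ i) (s≤s⁻¹ (subst (_≤ suc r) j≡1+i (s≤s⁻¹ (Fin.toℕ<n j)))))
    from i j (inj₂ (i≡0 , 1+j≡k)) = subst₂ (λ x y → Edge S (v x) (v y)) (sym i≡0) (sym (suc-injective 1+j≡k)) base

  component⇒polygon : ∀ {k} → PolygonalComponent S k → ∃[ r ] k ≡ suc (suc r) × ∃[ v ] Polygon S r v
  component⇒polygon {suc (suc (suc r))} pc = suc r , refl , corner ∘ (_mod k) , record
    { nonempty    = s≤s z≤n
    ; side        = λ i i≤ → Equivalence.from (edges (lt ≤-refl (s≤s i≤)))
                      (inj₁ (trans (at (s≤s i≤)) (cong suc (sym (at (m≤n⇒m≤1+n i≤))))))
    ; base        = Equivalence.from (edges (lt (s≤s z≤n) ≤-refl)) (inj₂ (at z≤n , cong suc (at ≤-refl)))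
    ; no-diagonal = no-diagonal
    }
    where
    open PolygonalComponent pc
    k = suc (suc (suc r))
    at : ∀ {i} → i ≤ suc (suc r) → toℕ (i mod k) ≡ i
    at {i} i≤ = trans (toℕ-mod i k) (m<n⇒m%n≡m (s≤s i≤))
    lt : ∀ {i j} → i < j → j ≤ suc (suc r) → toℕ (i mod k) < toℕ (j mod k)
    lt i<j j≤ = subst₂ _<_ (sym (at (≤-trans (<⇒≤ i<j) j≤))) (sym (at j≤)) i<j
    no-diagonal : ∀ {i j} → suc i < j → j ≤ suc (suc r) →
                  Edge S (corner (i mod k)) (corner (j mod k)) → i ≡ 0 × j ≡ suc (suc r)
    no-diagonal {i} {j} 1+i<j j≤ e with Equivalence.to (edges (lt (<-trans ≤-refl 1+i<j) j≤)) e
    ... | inj₁ eq = contradiction (trans (sym (trans eq (cong suc (at (≤-trans (<⇒≤ (<-trans ≤-refl 1+i<j)) j≤)))))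
                                    (at j≤))
                      (λ 1+i≡j → <-irrefl 1+i≡j 1+i<j)
    ... | inj₂ (i≡0 , 1+j≡k) = trans (sym (at (≤-trans (<⇒≤ (<-trans ≤-refl 1+i<j)) j≤))) i≡0 ,
                               trans (sym (at j≤)) (suc-injective 1+j≡k)
  component⇒polygon {suc (suc zero)} pc = contradiction (PolygonalComponent.3≤k pc) λ { (s≤s (s≤s ())) }
  component⇒polygon {suc zero} pc = contradiction (PolygonalComponent.3≤k pc) λ { (s≤s ()) }
  component⇒polygon {zero} pc = contradiction (PolygonalComponent.3≤k pc) λ ()

  module _ (nc : NonCrossing S) {r : ℕ} {v : ℕ → ℕ ⁺} (pg : Polygon S r v) where
    open Polygon pg

    -- An edge past the next corner would end between two corners and cross a side, or at a corner
    -- and be a diagonal, or behind the last corner and cross the base. Hence each side from an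
    -- inner corner is the longest edge from that corner. At the first corner this needs the
    -- restriction to edges shorter than the base.
    edge-from-inner : ∀ {i w} → 0 < i → i ≤ r → Edge S (v i) w → w <⁺ v (suc i) ⊎ w ≡ v (suc i)
    edge-from-first : ∀ {w} → Edge S (v 0) w → w <⁺ v (suc r) → w <⁺ v 1 ⊎ w ≡ v 1

    private
      edge-to-corner : ∀ {i w} → i ≤ r → Edge S (v i) w → v (suc i) <⁺ w →
                       w <⁺ v (suc r) ⊎ w ≡ v (suc r) → i ≡ 0 × w ≡ v (suc r)
      edge-to-corner {i} {w} i≤r e vi+1<w w≤ with m≤n⇒m<n∨m≡n i≤r
      ... | inj₂ refl = Data.Sum.[ (λ w<v → contradiction (<⁺-tr w<v vi+1<w) <⁺-irr)
                                 , (λ w≡v → contradiction (subst (v (suc r) <⁺_) w≡v vi+1<w) <⁺-irr) ] w≤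
      ... | inj₁ i<r with locate side (suc r) (s≤s i<r) ≤-refl vi+1<w w≤
      ...   | j , i<j , j<1+r , vj<w , inj₁ w<vj+1 =
        contradiction (corner-mono side i<j (<⇒≤ j<1+r) , vj<w , w<vj+1) (edges-noncrossing nc e (side j (s≤s⁻¹ j<1+r)))
      ...   | j , i<j , j<1+r , vj<w , inj₂ refl with no-diagonal (s≤s i<j) j<1+r e
      ...     | i≡0 , eq = i≡0 , cong v eq

    edge-from-inner {i} {w} 0<i i≤r e with <⁺-cmp-≡ <-cmp w (v (suc i))
    ... | tri< w< _ _ = inj₁ w<
    ... | tri≈ _ w≡ _ = inj₂ w≡
    ... | tri> _ _ >w with <⁺-cmp-≡ <-cmp w (v (suc r))
    ...   | tri< w< _ _ = contradiction 0<i (λ 0<i → <-irrefl (sym (proj₁ (edge-to-corner i≤r e >w (inj₁ w<)))) 0<i)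
    ...   | tri≈ _ w≡ _ = contradiction 0<i (λ 0<i → <-irrefl (sym (proj₁ (edge-to-corner i≤r e >w (inj₂ w≡)))) 0<i)
    ...   | tri> _ _ last<w = contradiction
      (corner-mono side 0<i (m≤n⇒m≤1+n i≤r) , corner-mono side (s≤s i≤r) ≤-refl , last<w)
      (edges-noncrossing nc base e)

    edge-from-first {w} e w<last with <⁺-cmp-≡ <-cmp w (v 1)
    ... | tri< w< _ _ = inj₁ w<
    ... | tri≈ _ w≡ _ = inj₂ w≡
    ... | tri> _ _ >w with edge-to-corner z≤n e >w (inj₁ w<last)
    ...   | _ , refl = contradiction w<last <⁺-irr

-- Numbering the chords at a vertex

module Ranks {N : ℕ} (S : ArcSet (suc N)) where
  private n = suc N
  open Edges S

  -- If `chordAt a d` holds, `rank a d` is the number of this chord among the chords at `a`, counted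
  -- from 0 and from the shortest.
  rank : ℕ → ℕ → ℕ
  rank a = Σ< (bit ∘ chordAt a)

  chordCounts : Vec ℕ n
  chordCounts = tabulate λ i → rank (toℕ i) N

  rank-mod : ∀ {a b} → a mod n ≡ b mod n → ∀ d → rank a d ≡ rank b d
  rank-mod {a} {b} e = Σ<-cong (λ d → cong bit (chordAt-mod a b e d))

  chordCounts-rank : ∀ a → lookup chordCounts (a mod n) ≡ rank a N
  chordCounts-rank a = trans (Vec.lookup∘tabulate (λ i → rank (toℕ i) N) (a mod n))
    (rank-mod (toℕ-mod-id (a mod n)) N)

  rank-suc : ∀ a d → ChordEdge a (a + suc (suc d)) → rank a (suc d) ≡ suc (rank a d)
  rank-suc a d e = trans (cong (_+_ (rank a d)) (bit-T (edge⇒chordAt e))) (+-comm (rank a d) 1)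

  rank-const : ∀ a {d e} → d ≤ e → (∀ {z} → a + suc d < z → z < a + suc (suc e) → ¬ ChordEdge a z) →
               rank a e ≡ rank a d
  rank-const a {d} {e} d≤e none = Σ<-const _ d≤e λ x d≤x x<e → bit-¬T λ t →
    none (+-monoʳ-< a (s≤s (s≤s d≤x))) (+-monoʳ-< a (s≤s (s≤s x<e))) (chord⇒edge a x t)

-- The corners of a polygon with a corner at •, which comes last in the order of the cover.
cap : ℕ → (ℕ → ℕ) → ℕ → ℕ ⁺
cap r f i with i ≤? r
... | yes _ = [ f i ]
... | no  _ = ⊤⁺

cap-≤ : ∀ {r f i} → i ≤ r → cap r f i ≡ [ f i ]
cap-≤ {r} {f} {i} i≤r with i ≤? r
... | yes _  = refl
... | no i≰r = contradiction i≤r i≰r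

cap-> : ∀ {r f i} → r < i → cap r f i ≡ ⊤⁺
cap-> {r} {f} {i} r<i with i ≤? r
... | yes i≤r = contradiction (<-≤-trans r<i i≤r) (<-irrefl refl)
... | no _ = refl

-- Heights of a given angulation

module Angulation {M N : ℕ} (S : ArcSet (suc N)) (ang : IsAngulation (suc M) S) where
  private
    m = suc M
    n = suc N

  open Edges S
  open Ranks S
  open Polygons S
  open IsAngulation ang
  open Heights m chordCounts

  private
    topData : ∀ a → ∃[ b ] suc a ≤ b × b ≤ a + n × ChordEdge a b × (∀ {z} → b < z → z ≤ a + n → ¬ ChordEdge a z)
    topData a = largest (chordEdge? a) (≤-trans (s≤s (m≤m+n a N)) (≤-reflexive (sym (+-suc a N)))) (boundary a)

  opaque
    top : ℕ → ℕ
    top a = proj₁ (topData a)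

    top-edge : ∀ a → ChordEdge a (top a)
    top-edge a = proj₁ (proj₂ (proj₂ (proj₂ (topData a))))

    top-max : ∀ {a z} → top a < z → ¬ ChordEdge a z
    top-max {a} <z e = proj₂ (proj₂ (proj₂ (proj₂ (topData a)))) <z (edge-≤ e) e

  -- Paths of longest edges. Between the ends of two consecutive edges at a vertex, or between two
  -- consecutive spokes, such a path completes a polygon.
  tops : ℕ → ℕ → ℕ
  tops x zero    = x
  tops x (suc i) = top (tops x i)

  tops-mono-< : ∀ x {i j} → i < j → tops x i < tops x j
  tops-mono-< x {i} {suc j} i<1+j with m≤n⇒m<n∨m≡n (s≤s⁻¹ i<1+j)
  ... | inj₁ i<j  = <-trans (tops-mono-< x i<j) (edge-< (top-edge (tops x j)))
  ... | inj₂ refl = edge-< (top-edge (tops x j))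

  tops-mono-≤ : ∀ x {i j} → i ≤ j → tops x i ≤ tops x j
  tops-mono-≤ x i≤j with m≤n⇒m<n∨m≡n i≤j
  ... | inj₁ i<j  = <⇒≤ (tops-mono-< x i<j)
  ... | inj₂ refl = ≤-refl

  -- Every edge advances by at least 1, so a path that cannot jump over `y` lands on it within `y`
  -- edges.
  tops-reach : ∀ {x y} → x ≤ y → (∀ {u v} → x ≤ u → u < y → ChordEdge u v → v ≤ y) → ∃[ r ] tops x r ≡ y
  tops-reach {x} {y} x≤y barrier = Data.Sum.[ id , (λ (x+y≤ , <y) →
    contradiction (<-≤-trans <y (≤-trans (m≤n+m y x) x+y≤)) (<-irrefl refl)) ] (advance y)
    where
    advance : ∀ i → (∃[ r ] tops x r ≡ y) ⊎ (x + i ≤ tops x i × tops x i < y)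
    advance zero with m≤n⇒m<n∨m≡n x≤y
    ... | inj₁ x<y = inj₂ (≤-reflexive (+-identityʳ x) , x<y)
    ... | inj₂ x≡y = inj₁ (0 , x≡y)
    advance (suc i) with advance i
    ... | inj₁ found = inj₁ found
    ... | inj₂ (x+i≤ , <y) with m≤n⇒m<n∨m≡n (barrier (tops-mono-≤ x {0} {i} z≤n) <y (top-edge (tops x i)))
    ...   | inj₁ next<y = inj₂ (≤-trans (≤-reflexive (+-suc x i))
        (≤-trans (s≤s x+i≤) (edge-< (top-edge (tops x i)))) , next<y)
    ...   | inj₂ next≡y = inj₁ (suc i , next≡y)

  path-length : ∀ {r v} → Polygon S r v → r ≡ m
  path-length {r} pg = +-cancelʳ-≡ 2 r m (trans (+-comm r 2) (all-[m+2]-gons _ (polygon⇒component pg)))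

  edge-barrier : ∀ {a b u v} → ChordEdge a b → a < u → u < b → ChordEdge u v → v ≤ b
  edge-barrier {b = b} {v = v} ab a<u u<b uv with v ≤? b
  ... | yes v≤b = v≤b
  ... | no v≰b = contradiction ([ a<u ] , [ u<b ] , [ ≰⇒> v≰b ]) (edges-noncrossing nonCrossing ab uv)

  -- From `a` no edge ends strictly between `x` and `b`, and from a vertex of the path no edge is
  -- longer than the side. So the closed path has no diagonals and bounds an (m+2)-gon, two of whose
  -- sides start at `a`.
  tops-between-edges : ∀ {a x b} → ChordEdge a x → ChordEdge a b → x < b →
                       (∀ {z} → x < z → z < b → ¬ ChordEdge a z) → tops x m ≡ b
  tops-between-edges {a} {x} {b} ax ab x<b none =
    trans (cong (tops x) (sym (path-length polygon))) tops-r
    where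
    barrier : ∀ {u v} → x ≤ u → u < b → ChordEdge u v → v ≤ b
    barrier x≤u = edge-barrier ab (<-≤-trans (edge-< ax) x≤u)
    r = proj₁ (tops-reach (<⇒≤ x<b) barrier)
    tops-r : tops x r ≡ b
    tops-r = proj₂ (tops-reach (<⇒≤ x<b) barrier)
    v : ℕ → ℕ ⁺
    v zero    = [ a ]
    v (suc i) = [ tops x i ]
    no-diagonal : ∀ {i j} → suc i < j → j ≤ suc r → Edge S (v i) (v j) → i ≡ 0 × j ≡ suc r
    no-diagonal {zero} {suc j} (s≤s 0<j) (s≤s j≤r) e with m≤n⇒m<n∨m≡n j≤r
    ... | inj₁ j<r = contradiction e (none (tops-mono-< x 0<j) (<-≤-trans (tops-mono-< x j<r) (≤-reflexive tops-r)))
    ... | inj₂ j≡r = refl , cong suc j≡r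
    no-diagonal {suc i} {suc j} (s≤s 1+i<j) _ e = contradiction e (top-max (tops-mono-< x 1+i<j))
    nonempty : ∀ r → x < tops x r → 1 ≤ r
    nonempty zero x<x = contradiction x<x (<-irrefl refl)
    nonempty (suc _) _ = s≤s z≤n
    polygon : Polygon S r v
    polygon = record
      { nonempty    = nonempty r (<-≤-trans x<b (≤-reflexive (sym tops-r)))
      ; side        = λ { zero _ → ax ; (suc i) _ → top-edge (tops x i) }
      ; base        = subst (ChordEdge a) (sym tops-r) ab
      ; no-diagonal = no-diagonal
      }

  -- The spoke at `q` stops the path from passing `q`, and `none` excludes diagonals that end at •.
  tops-between-spokes : ∀ {p q} → SpokeEdge p → SpokeEdge q → p < q →
                        (∀ {z} → p < z → z < q → ¬ SpokeEdge z) → tops p m ≡ q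
  tops-between-spokes {p} {q} sp sq p<q none =
    trans (cong (tops p) (sym (path-length polygon))) tops-r
    where
    barrier : ∀ {u v} → p ≤ u → u < q → ChordEdge u v → v ≤ q
    barrier {u} {v} _ u<q uv with v ≤? q
    ... | yes v≤q = v≤q
    ... | no v≰q = contradiction ([ u<q ] , [ ≰⇒> v≰q ] , [ _ ]<⊤⁺) (edges-noncrossing nonCrossing uv sq)
    r = proj₁ (tops-reach (<⇒≤ p<q) barrier)
    tops-r : tops p r ≡ q
    tops-r = proj₂ (tops-reach (<⇒≤ p<q) barrier)
    v : ℕ → ℕ ⁺
    v = cap r (tops p)
    no-diagonal : ∀ {i j} → suc i < j → j ≤ suc r → Edge S (v i) (v j) → i ≡ 0 × j ≡ suc r
    no-diagonal {i} {j} 1+i<j j≤1+r e with m≤n⇒m<n∨m≡n j≤1+r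
    ... | inj₁ j<1+r = contradiction
      (subst₂ (Edge S) (cap-≤ {f = tops p} i≤r) (cap-≤ {f = tops p} (s≤s⁻¹ j<1+r)) e)
      (top-max (tops-mono-< p 1+i<j))
      where
      i≤r : i ≤ r
      i≤r = ≤-trans (<⇒≤ (<-trans ≤-refl 1+i<j)) (s≤s⁻¹ j<1+r)
    no-diagonal {zero} {j} 1+i<j j≤1+r e | inj₂ refl = refl , refl
    no-diagonal {suc i} {j} 1+i<j j≤1+r e | inj₂ refl = contradiction
      (subst₂ (Edge S) (cap-≤ {f = tops p} (<⇒≤ (s≤s⁻¹ 1+i<j))) (cap-> {f = tops p} ≤-refl) e)
      (none (tops-mono-< p {0} {suc i} (s≤s z≤n)) (<-≤-trans (tops-mono-< p (s≤s⁻¹ 1+i<j)) (≤-reflexive tops-r)))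
    side : ∀ i → i ≤ r → Edge S (v i) (v (suc i))
    side i i≤r with m≤n⇒m<n∨m≡n i≤r
    ... | inj₁ i<r  = subst₂ (Edge S) (sym (cap-≤ {f = tops p} i≤r)) (sym (cap-≤ {f = tops p} i<r)) (top-edge (tops p i))
    ... | inj₂ refl = subst₂ (Edge S) (sym (cap-≤ {f = tops p} i≤r)) (sym (cap-> {f = tops p} ≤-refl))
      (subst SpokeEdge (sym tops-r) sq)
    nonempty : ∀ r → p < tops p r → 1 ≤ r
    nonempty zero p<p = contradiction p<p (<-irrefl refl)
    nonempty (suc _) _ = s≤s z≤n
    polygon : Polygon S r v
    polygon = record
      { nonempty    = nonempty r (<-≤-trans p<q (≤-reflexive (sym tops-r)))
      ; side        = side
      ; base        = subst₂ (Edge S) (sym (cap-≤ {r} {tops p} {0} z≤n)) (sym (cap-> {f = tops p} ≤-refl)) sp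
      ; no-diagonal = no-diagonal
      }

  private
    -- For a chord, `rank a d` includes the chord itself; for the boundary segment it is 0. The drop
    -- is measured from `suc a`, after the rise at `a`, so that each chord at `a` accounts for a
    -- drop of m.
    EdgeLaw : ℕ → Set
    EdgeLaw d = ∀ a → ChordEdge a (a + suc d) →
                H (suc a) ≡ + (m * rank a d) ℤ.+ H (a + suc d) × Low a (a + suc d)

    1+drop : ∀ {h h′ k l : ℤ} → sucℤ h′ ≡ h ℤ.+ k → h′ ≡ k ℤ.+ l → h ≡ 1ℤ ℤ.+ l
    1+drop {h} {h′} {k} {l} e e′ = +-cancelˡ-≡ℤ k (trans (trans (ℤ.+-comm k h) (sym e)) (trans (cong sucℤ e′) (ex k l)))
      where
      ex : ∀ k l → 1ℤ ℤ.+ (k ℤ.+ l) ≡ k ℤ.+ (1ℤ ℤ.+ l)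
      ex = solve-∀

    -- For the longest edge the rank is the full count `starts a`. The drop after `suc a` then
    -- cancels the rise in the step from `a` to `suc a`, and only the 1 of that step remains.
    top-drop : ∀ {a d} → top a ≡ a + suc d → EdgeLaw d → a ↘[ 1 ] top a
    top-drop {a} {d} eq law with law a (subst (ChordEdge a) eq (top-edge a))
    ... | e , low = subst (λ b → a ↘[ 1 ] b) (sym eq) record
      { drop = 1+drop {l = H (a + suc d)} (H-suc a) (trans e (cong (λ k → + (m * k) ℤ.+ H (a + suc d)) rank≡))
      ; low  = low
      }
      where
      d≤N : d ≤ N
      d≤N = s≤s⁻¹ (+-cancelˡ-≤ a (suc d) n (subst (_≤ a + n) eq (edge-≤ (top-edge a))))
      rank≡ : rank a d ≡ starts a
      rank≡ = sym (trans (chordCounts-rank a)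
        (rank-const a d≤N (λ {z} top<z _ → top-max (subst (_< z) (sym eq) top<z))))

    path-drop : ∀ {x} i → (∀ {u} → x ≤ u → u < tops x i → u ↘[ 1 ] top u) → x ↘[ i ] tops x i
    path-drop zero _ = ↘-refl
    path-drop {x} (suc i) law = subst (λ k → x ↘[ k ] tops x (suc i)) (+-comm i 1)
      (↘-trans (path-drop i (λ x≤u u< → law x≤u (<-trans u< (edge-< (top-edge (tops x i))))))
               (law (tops-mono-≤ x {0} {i} z≤n) (edge-< (top-edge (tops x i)))))

    edge-law-step : ∀ d → (∀ {d′} → d′ < d → EdgeLaw d′) → EdgeLaw d
    edge-law-step zero _ a _ =
      trans (cong H (+-comm 1 a)) (trans (sym (ℤ.+-identityˡ _)) (cong (λ z → + z ℤ.+ H (a + 1)) (sym (*-zeroʳ m)))) ,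
      λ x x<a+1 a<x → contradiction (a<x , subst (x <_) (+-comm a 1) x<a+1) no-between
    edge-law-step (suc d) rec a ab
      with largest (chordEdge? a) (≤-trans (s≤s (m≤m+n a d)) (≤-reflexive (sym (+-suc a d)))) (boundary a)
    ... | x , a<x , x≤ , ax , max with m≤n⇒∃[o]m+o≡n a<x
    ... | d₀ , refl = drop-b , Low-trans (↘-⋖ x↘b) (subst (Low a) (+-suc a d₀) (proj₂ ax-law)) (x↘b .low)
      where
      open ≡-Reasoning
      b = a + suc (suc d)
      b≡ : b ≡ suc (a + suc d)
      b≡ = +-suc a (suc d)
      x<b : suc (a + d₀) < b
      x<b = subst (suc (a + d₀) <_) (sym b≡) (s≤s x≤)
      d₀≤d : d₀ ≤ d
      d₀≤d = s≤s⁻¹ (+-cancelˡ-≤ a (suc d₀) (suc d) (subst (_≤ a + suc d) (sym (+-suc a d₀)) x≤))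
      none : ∀ {z} → suc (a + d₀) < z → z < b → ¬ ChordEdge a z
      none {z} x<z z<b = max x<z (s≤s⁻¹ (subst (z <_) b≡ z<b))
      tops≡b : tops (suc (a + d₀)) m ≡ b
      tops≡b = tops-between-edges ax ab x<b none
      -- The longest edge from `u` starts after `a` and, by `edge-barrier`, ends no later than `b`.
      -- It is shorter than the edge from `a` to `b`, so the induction hypothesis applies.
      top-law : ∀ {u} → suc (a + d₀) ≤ u → u < tops (suc (a + d₀)) m → u ↘[ 1 ] top u
      top-law {u} x≤u u<tops with m≤n⇒∃[o]m+o≡n (edge-< (top-edge u))
      ... | dᵤ , eq = top-drop (trans (sym eq) (sym (+-suc u dᵤ))) (rec (s≤s (+-cancelˡ-≤ (suc a) dᵤ d
              (≤-trans (≤-trans (+-monoˡ-≤ dᵤ (≤-trans a<x x≤u)) (s≤s⁻¹ (subst (_≤ suc (a + suc d)) (sym eq) top≤)))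
                       (≤-reflexive (+-suc a d))))))
        where
        top≤ : top u ≤ suc (a + suc d)
        top≤ = subst (top u ≤_) b≡ (edge-barrier ab (<-≤-trans a<x x≤u) (subst (u <_) tops≡b u<tops) (top-edge u))
      x↘b : suc (a + d₀) ↘[ m ] b
      x↘b = subst (λ z → suc (a + d₀) ↘[ m ] z) tops≡b (path-drop m top-law)
      ax-law = rec (s≤s d₀≤d) a (subst (ChordEdge a) (sym (+-suc a d₀)) ax)
      rank≡ : m + m * rank a d₀ ≡ m * rank a (suc d)
      rank≡ = sym (trans (cong (m *_) (trans (rank-suc a d ab) (cong suc (rank-const a d₀≤d
        (λ {z} <z z< → none (subst (_< z) (+-suc a d₀) <z) z<))))) (*-suc m (rank a d₀)))
      drop-b : H (suc a) ≡ + (m * rank a (suc d)) ℤ.+ H b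
      drop-b = begin
        H (suc a)                                               ≡⟨ proj₁ ax-law ⟩
        + (m * rank a d₀) ℤ.+ H (a + suc d₀)                    ≡⟨ cong (λ z → + (m * rank a d₀) ℤ.+ H z) (+-suc a d₀) ⟩
        + (m * rank a d₀) ℤ.+ H (suc (a + d₀))                  ≡⟨ cong (ℤ._+_ (+ (m * rank a d₀))) (x↘b .drop) ⟩
        + (m * rank a d₀) ℤ.+ (+ m ℤ.+ H b)                     ≡⟨ ex (+ (m * rank a d₀)) (+ m) (H b) ⟩
        + m ℤ.+ + (m * rank a d₀) ℤ.+ H b                       ≡⟨ cong (λ z → z ℤ.+ H b) (sym (ℤ.pos-+ m (m * rank a d₀))) ⟩
        + (m + m * rank a d₀) ℤ.+ H b                           ≡⟨ cong (λ z → + z ℤ.+ H b) rank≡ ⟩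
        + (m * rank a (suc d)) ℤ.+ H b                          ∎
        where
        ex : ∀ x y z → x ℤ.+ (y ℤ.+ z) ≡ y ℤ.+ x ℤ.+ z
        ex = solve-∀

  -- By induction on the length: the edge from a to b, the next shorter edge
  -- from a to some x, and the longest edges on the way from x to b bound a
  -- polygon, so there are m of the latter, and H drops by 1 along each.
  edge-law : ∀ a d → ChordEdge a (a + suc d) →
             H (suc a) ≡ + (m * rank a d) ℤ.+ H (a + suc d) × Low a (a + suc d)
  edge-law a d = <-rec EdgeLaw edge-law-step d a

  consecutive-spokes : ∀ {p q} → SpokeEdge p → SpokeEdge q → p < q →
                       (∀ {z} → p < z → z < q → ¬ SpokeEdge z) → p ↘[ m ] q
  consecutive-spokes {p} sp sq p<q none = subst (λ z → p ↘[ m ] z) (tops-between-spokes sp sq p<q none)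
    (path-drop m top-law)
    where
    top-law : ∀ {u} → p ≤ u → u < tops p m → u ↘[ 1 ] top u
    top-law {u} _ _ with m≤n⇒∃[o]m+o≡n (edge-< (top-edge u))
    ... | d , eq = top-drop (trans (sym eq) (sym (+-suc u d))) (λ a → edge-law a d)

  spokesBefore : ℕ → ℕ
  spokesBefore = Σ< (bit ∘ spokeAt)

  spokes-drop : ∀ {p q} → SpokeEdge p → SpokeEdge q → p < q →
                ∃[ k ] p ↘[ m * suc k ] q × spokesBefore q ≡ suc k + spokesBefore p
  spokes-drop {p} {q} sp sq p<q = <-rec Claim step q sq p<q
    where
    Claim : ℕ → Set
    Claim q = SpokeEdge q → p < q → ∃[ k ] p ↘[ m * suc k ] q × spokesBefore q ≡ suc k + spokesBefore p
    step : ∀ q → (∀ {q′} → q′ < q → Claim q′) → Claim q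
    step (suc q) rec sq p<1+q with largest spokeEdge? (s≤s⁻¹ p<1+q) sp
    ... | q′ , p≤q′ , q′≤q , sq′ , max = extend (m≤n⇒m<n∨m≡n p≤q′)
      where
      last : q′ ↘[ m ] suc q
      last = consecutive-spokes sq′ sq (s≤s q′≤q) (λ q′<z z<1+q → max q′<z (s≤s⁻¹ z<1+q))
      count : spokesBefore (suc q) ≡ suc (spokesBefore q′)
      count = trans (Σ<-const _ (s≤s q′≤q) (λ x q′<x x<1+q → bit-¬T (λ t → max q′<x (s≤s⁻¹ x<1+q) (spoke⇒edge x t))))
        (trans (cong (_+_ (spokesBefore q′)) (bit-T (edge⇒spoke sq′))) (+-comm (spokesBefore q′) 1))
      extend : p < q′ ⊎ p ≡ q′ → ∃[ k ] p ↘[ m * suc k ] suc q × spokesBefore (suc q) ≡ suc k + spokesBefore p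
      extend (inj₂ refl) = 0 , subst (λ k → p ↘[ k ] suc q) (sym (*-identityʳ m)) last , count
      extend (inj₁ p<q′) with rec (s≤s q′≤q) sq′ p<q′
      ... | k , d , e = suc k
        , subst (λ k → p ↘[ k ] suc q) (trans (+-comm (m * suc k) m) (sym (*-suc m (suc k)))) (↘-trans d last)
        , trans count (cong suc e)

  spokes-deep : ∀ {p q} → SpokeEdge p → SpokeEdge q → p < q → H q ⋖ H p × Low p q
  spokes-deep sp sq p<q with spokes-drop sp sq p<q
  ... | k , d , _ = ↘-⋖ d , d .low

  spokes-residue : ∀ {p q} → SpokeEdge p → SpokeEdge q → p < q → p ≅ q
  spokes-residue sp sq p<q with spokes-drop sp sq p<q
  ... | k , d , _ = drop⇒≅ (suc k) (d .drop)

  somewhere : ∃[ p ] SpokeEdge p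
  somewhere = toℕ (proj₁ hasSpoke) + 0 * n ,
    spoke⇒edge _ (subst (λ i → T (S (spoke i))) (sym (toℕ+kn-mod (proj₁ hasSpoke) 0)) (proj₂ hasSpoke))

  -- Compare a spoke with its translate by one turn. H falls by m for each spoke passed, and also by
  -- n - m * sum chordCounts, since the counts are periodic.
  euler : n ≡ m * (sum chordCounts + #spokes S)
  euler with somewhere
  ... | p , sp with spokes-drop sp (subst SpokeEdge (cong (_+_ p) (*-identityˡ n)) (spokeEdge-shift 1 sp)) (m<m+n p z<s)
  ...   | k , d , count = +-cancelˡ-≡ (m * Σ< starts p + p) _ _ (begin
    m * Σ< starts p + p + n                                   ≡⟨ +-assoc (m * Σ< starts p) p n ⟩
    m * Σ< starts p + (p + n)                                 ≡⟨ drop⇒ (d .drop) ⟩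
    m * suc k + m * Σ< starts (p + n) + p                     ≡⟨ cong₂ (λ x y → m * x + m * y + p) spokes≡ (Σ<-starts-shift p) ⟩
    m * #spokes S + m * (Σ< starts p + sum chordCounts) + p   ≡⟨ ex m (#spokes S) (Σ< starts p) (sum chordCounts) p ⟩
    m * Σ< starts p + p + m * (sum chordCounts + #spokes S)   ∎)
    where
    open ≡-Reasoning
    ex : ∀ m s g c p → m * s + m * (g + c) + p ≡ m * g + p + m * (c + s)
    ex = ℕS.solve-∀
    total : spokesBefore (p + n) ≡ spokesBefore p + #spokes S
    total = trans (Σ<-periodic (bit ∘ spokeAt) n
                    (λ a → cong (λ i → bit (S (spoke i))) (%≡⇒mod≡ {a + n} {a} ([m+n]%n≡m%n a n))) p)
      (cong (_+_ (spokesBefore p)) (sym (card≡Σ< (S ∘ spoke) (bit ∘ spokeAt)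
        (λ i → cong (λ j → bit (S (spoke j))) (toℕ-mod-id i)))))
    spokes≡ : suc k ≡ #spokes S
    spokes≡ = +-cancelˡ-≡ (spokesBefore p) _ _ (trans (+-comm (spokesBefore p) (suc k)) (trans (sym count) total))

-- A running count rises by at most 1 at a time. This finds the chord with a prescribed number.
Σ<-bit-onto : ∀ f N {k} → k < Σ< (bit ∘ f) N → ∃[ d ] d < N × T (f d) × Σ< (bit ∘ f) d ≡ k
Σ<-bit-onto f (suc N) {k} k< with k <? Σ< (bit ∘ f) N
... | yes k<′ with Σ<-bit-onto f N k<′
...   | d , d<N , t , e = d , m<n⇒m<1+n d<N , t , e
Σ<-bit-onto f (suc N) {k} k< | no k≮ with f N in eq
...   | true  = N , ≤-refl , subst T (sym eq) _ ,
                ≤-antisym (≮⇒≥ k≮) (s≤s⁻¹ (≤-trans k< (≤-reflexive (+-comm (Σ< (bit ∘ f) N) 1))))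
...   | false = contradiction (≤-trans k< (≤-reflexive (+-identityʳ _))) k≮

≤⇒drop : ∀ {i j} → i ℤ.≤ j → ∃[ r ] j ≡ + r ℤ.+ i
≤⇒drop {i} {j} i≤j with ℤ.i≤j⇒0≤j-i i≤j
... | 0≤ = ℤ.∣ j ℤ.- i ∣ , trans (sym (minus-plus j i)) (cong (λ z → z ℤ.+ i) (sym (ℤ.0≤i⇒+∣i∣≡i 0≤)))

drop-< : ∀ {h i q r s} → h ≡ + r ℤ.+ i → h ≡ + s ℤ.+ q → q ⋖ i → r < s
drop-< {h} {i} {q} {r} {s} e e′ q⋖i = ℤ.drop‿+≤+ (+-cancelˡ-≤ℤ q (subst₂ ℤ._≤_ (ex (+ r) q)
  (trans (sym e) (trans e′ (ℤ.+-comm (+ s) q))) (ℤ.+-monoʳ-≤ (+ r) q⋖i)))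
  where
  ex : ∀ r q → r ℤ.+ (1ℤ ℤ.+ q) ≡ q ℤ.+ (1ℤ ℤ.+ r)
  ex = solve-∀

drop-positive : ∀ {h i r} → h ≡ + r ℤ.+ i → i ⋖ h → 0 < r
drop-positive {r = suc _} _ _ = z<s
drop-positive {h} {i} {zero} e i⋖h = contradiction i⋖h (λ p → ⋖⇒≱ {i} p (ℤ.≤-reflexive (trans e (ℤ.+-identityˡ _))))

-- Uniqueness: chord counts and residue class determine the angulation

module Comparison {M N : ℕ} {S S′ : ArcSet (suc N)}
  (ang : IsAngulation (suc M) S) (ang′ : IsAngulation (suc M) S′)
  (counts≡ : Ranks.chordCounts S′ ≡ Ranks.chordCounts S)
  where
  private
    m = suc M
    n = suc N
    module E  = Edges S
    module E′ = Edges S′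
    module R  = Ranks S
    module R′ = Ranks S′
    module A  = Angulation S ang
    module A′ = Angulation S′ ang′
  open Heights m R.chordCounts

  private
    edge-law′ : ∀ a d → E′.ChordEdge a (a + suc d) →
                H (suc a) ≡ + (m * R′.rank a d) ℤ.+ H (a + suc d) × Low a (a + suc d)
    edge-law′ = subst (λ c → ∀ a d → E′.ChordEdge a (a + suc d) →
                Heights.H m c (suc a) ≡ + (m * R′.rank a d) ℤ.+ Heights.H m c (a + suc d) ×
                Heights.Low m c a (a + suc d)) counts≡ A′.edge-law

    consecutive-spokes′ : ∀ {p q} → E′.SpokeEdge p → E′.SpokeEdge q → p < q →
                          (∀ {z} → p < z → z < q → ¬ E′.SpokeEdge z) → p ↘[ m ] q
    consecutive-spokes′ {p} {q} = subst (λ c → E′.SpokeEdge p → E′.SpokeEdge q → p < q →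
                          (∀ {z} → p < z → z < q → ¬ E′.SpokeEdge z) → Heights._↘[_]_ m c p m q)
                          counts≡ A′.consecutive-spokes

    straddle′ : ∀ {p x} q → E′.SpokeEdge p → E′.SpokeEdge q → p ≤ x → x < q →
                ∃[ p′ ] ∃[ q′ ] p ≤ p′ × p′ ≤ x × x < q′ × E′.SpokeEdge p′ × p′ ↘[ m ] q′
    straddle′ {p} {x} = <-rec _ step
      where
      step : ∀ q → (∀ {r} → r < q → E′.SpokeEdge p → E′.SpokeEdge r → p ≤ x → x < r →
                ∃[ p′ ] ∃[ q′ ] p ≤ p′ × p′ ≤ x × x < q′ × E′.SpokeEdge p′ × p′ ↘[ m ] q′) →
             E′.SpokeEdge p → E′.SpokeEdge q → p ≤ x → x < q →
                ∃[ p′ ] ∃[ q′ ] p ≤ p′ × p′ ≤ x × x < q′ × E′.SpokeEdge p′ × p′ ↘[ m ] q′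
      step (suc q) rec sp sq p≤x x<1+q with largest E′.spokeEdge? (≤-trans p≤x (s≤s⁻¹ x<1+q)) sp
      ... | r , p≤r , r≤q , sr , max with r ≤? x
      ...   | yes r≤x = r , suc q , p≤r , r≤x , x<1+q , sr ,
                        consecutive-spokes′ sr sq (s≤s r≤q) (λ r<z z<1+q → max r<z (s≤s⁻¹ z<1+q))
      ...   | no r≰x  = rec (s≤s r≤q) sp sr p≤x (≰⇒> r≰x)

  -- As the counts at `a` agree, S′ has a chord at `a` with the same number. By the edge law both
  -- chords end at the same height, each at the first point after `a` of that height.
  chord-transfer : ∀ a d → T (E.chordAt a d) → T (E′.chordAt a d)
  chord-transfer a d t = finish (Σ<-bit-onto (E′.chordAt a) N rank<)
    where
    rank< : R.rank a d < R′.rank a N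
    rank< = ≤-trans (≤-reflexive (sym (R.rank-suc a d (E.chord⇒edge a d t))))
      (≤-trans (Σ<-mono _ (E.chordAt-< a d t))
        (≤-reflexive (trans (sym (R.chordCounts-rank a)) (trans (cong (λ c → lookup c (a mod n)) (sym counts≡))
          (R′.chordCounts-rank a)))))
    finish : ∃[ d′ ] d′ < N × T (E′.chordAt a d′) × R′.rank a d′ ≡ R.rank a d → T (E′.chordAt a d)
    finish (d′ , d′<N , t′ , rank≡) = subst (T ∘ E′.chordAt a) (sym d≡d′) t′
      where
      e  = E.chord⇒edge a d t
      e′ = E′.chord⇒edge a d′ t′
      law  = A.edge-law a (suc d) e
      law′ = edge-law′ a (suc d′) e′
      ranks : R.rank a (suc d) ≡ R′.rank a (suc d′)
      ranks = trans (R.rank-suc a d e) (trans (cong suc (sym rank≡)) (sym (R′.rank-suc a d′ e′)))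
      H≡ : H (a + suc (suc d)) ≡ H (a + suc (suc d′))
      H≡ = +-cancelˡ-≡ℤ (+ (m * R.rank a (suc d))) (trans (sym (proj₁ law)) (trans (proj₁ law′)
        (cong (λ k → + (m * k) ℤ.+ H (a + suc (suc d′))) (sym ranks))))
      d≡d′ : d ≡ d′
      d≡d′ = suc-injective (suc-injective (+-cancelˡ-≡ a _ _
        (Low-unique H≡ (proj₂ law) (proj₂ law′) (E.edge-< e) (E′.edge-< e′))))

  -- Consecutive spokes of S′ around a′ have heights m apart, and the height of
  -- a′ is strictly in between unless a′ is one of them.  But the residue of a′
  -- makes it congruent to them mod m.
  spoke-transfer : (∀ {a b} → E.SpokeEdge a → E′.SpokeEdge b → a ≅ b) →
                   ∀ a → E.SpokeEdge a → E′.SpokeEdge a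
  spoke-transfer residue a sa = E′.spokeEdge-mod ([m+kn]%n≡m%n a t n) (finish (straddle′ y sx sy x≤a′ a′<y))
    where
    p = proj₁ A′.somewhere
    -- Translations arrange a < x ≤ a′ < y with `a` and `a′` spokes of S, `x` and `y` spokes of S′.
    -- The spoke of S at `a`, left of everything else, makes `a′` lower than any spoke `p′` of S′
    -- with x ≤ p′ < a′.
    x = p + suc a * n
    sx = E′.spokeEdge-shift (suc a) (proj₂ A′.somewhere)
    t = suc x
    a′ = a + t * n
    sa′ = E.spokeEdge-shift t sa
    y = x + suc a′ * n
    sy = E′.spokeEdge-shift (suc a′) sx
    k≤kn : ∀ k → k ≤ k * n
    k≤kn k = m≤m*n k n
    a<x : a < x
    a<x = ≤-trans (k≤kn (suc a)) (m≤n+m _ p)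
    x≤a′ : x ≤ a′
    x≤a′ = ≤-trans (n≤1+n x) (≤-trans (k≤kn (suc x)) (m≤n+m _ a))
    a′<y : a′ < y
    a′<y = ≤-trans (k≤kn (suc a′)) (m≤n+m _ x)
    finish : (∃[ p′ ] ∃[ q′ ] x ≤ p′ × p′ ≤ a′ × a′ < q′ × E′.SpokeEdge p′ × p′ ↘[ m ] q′) → E′.SpokeEdge a′
    finish (p′ , q′ , x≤p′ , p′≤a′ , a′<q′ , sp′ , p′↘q′) with m≤n⇒m<n∨m≡n p′≤a′
    ... | inj₂ refl = sp′
    ... | inj₁ p′<a′ = contradiction r<m (≤⇒≯ (∣⇒≤ {{>-nonZero 0<r}} m∣r))
      where
      Ha′⋖Hp′ : H a′ ⋖ H p′
      Ha′⋖Hp′ = proj₂ (A.spokes-deep sa sa′ (≤-<-trans (<⇒≤ a<x) (≤-<-trans x≤p′ p′<a′))) p′ p′<a′ (<-≤-trans a<x x≤p′)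
      drop-r = ≤⇒drop (⋖⇒≤ {H a′} Ha′⋖Hp′)
      r = proj₁ drop-r
      0<r : 0 < r
      0<r = drop-positive {i = H a′} (proj₂ drop-r) Ha′⋖Hp′
      r<m : r < m
      r<m = drop-< {i = H a′} {q = H q′} (proj₂ drop-r) (p′↘q′ .drop) (p′↘q′ .low a′ a′<q′ p′<a′)
      m∣r : m ∣ r
      m∣r = drop⇒∣ {p′} {a′} (sym (residue sa′ sp′)) (proj₂ drop-r)

-- To be read with h = H a, h₁ = H (a + 1), hb = H b and K = m * starts a. Then `shallow` says that
-- the drop q from a + 1 to b is at most the rise K at a, that is, that the supply of chords at a is
-- not exceeded.
shallow⇔ : ∀ {h h₁ hb : ℤ} {q K : ℕ} → sucℤ h₁ ≡ h ℤ.+ + K → h₁ ≡ + q ℤ.+ hb →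
           (h ℤ.≤ sucℤ hb → q ≤ K) × (q ≤ K → h ℤ.≤ sucℤ hb)
shallow⇔ {h} {h₁} {hb} {q} {K} e e′ =
  (λ h≤ → ℤ.drop‿+≤+ (+-cancelˡ-≤ℤ (sucℤ hb) (subst (ℤ._≤ sucℤ hb ℤ.+ + K) K+h (ℤ.+-monoˡ-≤ (+ K) h≤)))) ,
  (λ q≤K → +-cancelˡ-≤ℤ (+ K) (subst₂ ℤ._≤_ (trans (sym K+h) (ℤ.+-comm h (+ K))) (ℤ.+-comm (sucℤ hb) (+ K))
    (ℤ.+-monoʳ-≤ (sucℤ hb) (ℤ.+≤+ q≤K))))
  where
  ex : ∀ q x → 1ℤ ℤ.+ (q ℤ.+ x) ≡ 1ℤ ℤ.+ x ℤ.+ q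
  ex = solve-∀
  K+h : h ℤ.+ + K ≡ sucℤ hb ℤ.+ + q
  K+h = trans (sym e) (trans (cong sucℤ e′) (ex (+ q) hb))

-- Existence: the angulation of a composition and a residue class

module Construction {M N : ℕ} (c : Vec ℕ (suc N)) {p : ℕ} (p<m : p < suc M) {s : ℕ}
  (n≡ : suc N ≡ suc M * sum c + suc M * suc s) where
  private
    m = suc M
    n = suc N
    δ = m * suc s

    1≤δ : 1 ≤ δ
    1≤δ = s≤s z≤n

    m∣n : m ∣ n
    m∣n = subst (m ∣_) (sym n≡) (∣m∣n⇒∣m+n (m∣m*n (sum c)) (m∣m*n (suc s)))

  open Heights m c
  open Periodicity n≡

  -- As H (a + n) = H a - m (suc s), Low a (a + n) says that H a < H x for all
  -- x < a when H is extended to ℤ.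
  RecordLow : ℕ → Set
  RecordLow a = a % m ≡ p × Low a (a + n)

  recordLow? : ∀ a → Dec (RecordLow a)
  recordLow? a = (a % m ≟ p) ×-dec Low? a (a + n)

  angulation : ArcSet n
  angulation (chord i d) = ⌊ admissible? (toℕ i) (toℕ i + suc (suc (toℕ d))) ⌋
  angulation (spoke i)   = ⌊ recordLow? (toℕ i) ⌋

  open Edges angulation
  open Ranks angulation
  open Polygons angulation

  private
    swap-last : ∀ x y z → x + y + z ≡ x + z + y
    swap-last = ℕS.solve-∀

  H-next : ∀ a → sucℤ (H (a + n)) ℤ.≤ H a
  H-next a = subst (sucℤ (H (a + n)) ℤ.≤_) (sym (H-shift a)) (ℤ.+-monoˡ-≤ (H (a + n)) (ℤ.+≤+ 1≤δ))

  -- If a + n were strictly between a and b, then H b < H (a + n) < H a would put b at least 2 below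
  -- a, against `shallow`.
  admissible-length : ∀ {a b} → Admissible a b → b ≤ a + n
  admissible-length {a} {b} adm with b ≤? a + n
  ... | yes b≤ = b≤
  ... | no b≰ = contradiction (ℤ.≤-trans (H-next a) (adm .shallow))
    (λ p → ⋖⇒≱ {H b} (adm .deep (a + n) (≰⇒> b≰) (m<m+n a z<s)) (suc-≤⁻¹ p))

  boundary-admissible : ∀ a → Admissible a (suc a)
  boundary-admissible a = record
    { ordered = ≤-refl
    ; residue = refl
    ; shallow = H-step a
    ; deep    = λ x x<1+a a<x → contradiction (a<x , x<1+a) no-between
    }

  edge⇒admissible : ∀ {a b} → ChordEdge a b → Admissible a b
  edge⇒admissible (boundary a) = boundary-admissible a
  edge⇒admissible (arc α∈ (chord i d t)) = subst (Admissible _) (swap-last (toℕ i) (suc (suc (toℕ d))) (t * n))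
    (shift-Admissible m∣n t (toWitness α∈))

  admissible⇒edge : ∀ {a b} → Admissible a b → ChordEdge a b
  admissible⇒edge {a} adm with m≤n⇒∃[o]m+o≡n (adm .ordered)
  ... | zero , refl = subst (ChordEdge a) (sym (+-identityʳ (suc a))) (boundary a)
  ... | suc d , refl = subst (ChordEdge a) (+-suc a (suc d)) (chord⇒edge a d
    (subst T (trans (sym (chordAt-toℕ a (fromℕ< d<N))) (cong (chordAt a) (Fin.toℕ-fromℕ< d<N)))
      (fromWitness (unshift-Admissible m∣n (a / n) adm′))))
    where
    d<N : d < N
    d<N = s≤s⁻¹ (+-cancelˡ-≤ a (suc (suc d)) n (subst (_≤ a + n) (sym (+-suc a (suc d))) (admissible-length adm)))
    i = toℕ (a mod n)
    adm′ : Admissible (i + a / n * n) (i + suc (suc (toℕ (fromℕ< d<N))) + a / n * n)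
    adm′ = subst₂ Admissible (sym (lift-shift a n))
      (trans (sym (+-suc a (suc d))) (trans (cong₂ (λ x y → x + suc (suc y)) (sym (lift-shift a n))
          (sym (Fin.toℕ-fromℕ< d<N)))
             (swap-last i (a / n * n) (suc (suc (toℕ (fromℕ< d<N))))))) adm

  edge⇒recordLow : ∀ {a} → SpokeEdge a → RecordLow a
  edge⇒recordLow {a} e with toWitness {a? = recordLow? (toℕ (a mod n))} (edge⇒spoke e)
  ... | a%m , low = trans (cong (_% m) (sym (lift-shift a n))) (trans (shift-≅ m∣n (toℕ (a mod n)) (a / n)) a%m) ,
    subst₂ Low (lift-shift a n) (trans (swap-last (toℕ (a mod n)) n (a / n * n)) (cong (_+ n) (lift-shift a n)))
      (shift-Low (a / n) low)

  recordLow⇒edge : ∀ {a} → RecordLow a → SpokeEdge a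
  recordLow⇒edge {a} (a%m , low) = spoke⇒edge a (fromWitness {a? = recordLow? (toℕ (a mod n))}
    ( trans (sym (shift-≅ m∣n (toℕ (a mod n)) (a / n))) (trans (cong (_% m) (lift-shift a n)) a%m)
    , unshift-Low (a / n) (subst₂ Low (sym (lift-shift a n))
        (trans (cong (_+ n) (sym (lift-shift a n))) (swap-last (toℕ (a mod n)) (a / n * n) n)) low)))

  -- Moving x one turn to the right lowers its height, so it is enough to treat the last turn before
  -- `a`. There `Low a (a + n)`, translated back by n, applies.
  recordLow-below : ∀ {a} → RecordLow a → ∀ {x} → x < a → H a ⋖ H x
  recordLow-below {a} (_ , low) {x} x<a = go a x x<a (≤-trans (m≤m*n a n) (m≤n+m (a * n) x))
    where
    go : ∀ t x → x < a → a ≤ x + t * n → H a ⋖ H x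
    go zero x x<a a≤x = contradiction (<-≤-trans x<a (subst (a ≤_) (+-identityʳ x) a≤x)) (<-irrefl refl)
    go (suc t) x x<a a≤ with <-cmp a (x + n)
    ... | tri< a<x+n _ _ = unshift-⋖ 1 (subst₂ (λ y z → H y ⋖ H z) (cong (_+_ a) (sym (*-identityˡ n)))
                             (cong (_+_ x) (sym (*-identityˡ n)))
                             (low (x + n) (+-monoˡ-< n x<a) a<x+n))
    ... | tri≈ _ refl _ = H-next x
    ... | tri> _ _ x+n<a = ℤ.≤-trans (go t (x + n) x+n<a (subst (a ≤_) (sym (+-assoc x n (t * n))) a≤))
      (⋖⇒≤ {H (x + n)} (H-next x))

  -- Up to a + n the points are at least as high as a + n, which lies above b + n; after a + n the
  -- translate of `Low a b` takes over.
  recordLow-next : ∀ {a b} → RecordLow a → a < b → H b ⋖ H a → Low a b → a ≅ b → RecordLow b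
  recordLow-next {a} {b} (a%m , low) a<b Hb⋖Ha low-ab a≅b = trans (sym a≅b) a%m , low-b
    where
    n≡1*n = sym (*-identityˡ n)
    low-b : Low b (b + n)
    low-b x x<b+n b<x = Low-trans {a} (subst₂ (λ y z → H y ⋖ H z) (cong (_+_ b) (sym n≡1*n)) (cong (_+_ a) (sym n≡1*n))
      (shift-⋖ 1 Hb⋖Ha))
      low
      (subst₂ Low (cong (_+_ a) (sym n≡1*n)) (cong (_+_ b) (sym n≡1*n)) (shift-Low 1 low-ab)) x x<b+n (<-trans a<b b<x)

  -- For two chords with a < z < b < w, H b < H z ≤ H w + 1 ≤ H b. For a chord from a to b and a
  -- spoke at z between them, H z < H a ≤ H b + 1 ≤ H z.
  edges-uncrossed : ∀ {x y z w} → Edge angulation x y → Edge angulation z w → ¬ Interleaved x y z w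
  edges-uncrossed {[ a ]} {[ b ]} {[ z ]} {[ w ]} e f ([ a<z ] , [ z<b ] , [ b<w ]) =
    ⋖⇒≱ {H b} (edge⇒admissible e .deep z z<b a<z)
      (ℤ.≤-trans (edge⇒admissible f .shallow) (edge⇒admissible f .deep b b<w z<b))
  edges-uncrossed {[ a ]} {[ b ]} {[ z ]} {⊤⁺} e f ([ a<z ] , [ z<b ] , _) =
    ⋖⇒≱ {H z} (recordLow-below (edge⇒recordLow f) a<z)
      (ℤ.≤-trans (edge⇒admissible e .shallow) (edge⇒admissible e .deep z z<b a<z))

  nonCrossing : NonCrossing angulation
  nonCrossing α β α∈ β∈ (x , y , z , w , p , q , inj₁ il) = edges-uncrossed (arc α∈ p) (arc β∈ q) il
  nonCrossing α β α∈ β∈ (x , y , z , w , p , q , inj₂ il) = edges-uncrossed (arc β∈ q) (arc α∈ p) il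

  -- From 0, H first drops by n + p at a point b with b ≡ n + p mod m.  As H
  -- drops by at most 1 per step, b ≥ n, so b - n is a record low.
  hasSpoke : ∃[ i ] spoke i ∈ angulation
  hasSpoke = finish (hit h (t * n) 0 h≤ ≤h)
    where
    t = n + p
    h = H 0 ℤ.- + t
    t+h : H 0 ≡ + t ℤ.+ h
    t+h = trans (sym (minus-plus (H 0) (+ t))) (ℤ.+-comm h (+ t))
    h≤ : h ℤ.≤ H 0
    h≤ = subst (h ℤ.≤_) (sym t+h) (ℤ.i≤j+i h (+ t))
    -- Each turn lowers H by δ ≥ 1, so t turns lower it by at least t.
    ≤h : H (t * n + 0) ℤ.≤ h
    ≤h = +-cancelˡ-≤ℤ (+ t) (subst₂ ℤ._≤_ (cong (λ z → + t ℤ.+ H z) (sym (+-identityʳ (t * n))))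
      (trans (sym (H-shift* 0 t)) t+h)
      (ℤ.+-monoˡ-≤ (H (t * n)) (ℤ.+≤+ (m≤m*n t δ))))
    finish : ∃[ b ] 0 ≤ b × b ≤ t * n + 0 × H b ≡ h × (∀ {z} → 0 ≤ z → z < b → h ⋖ H z) → ∃[ i ] spoke i ∈ angulation
    finish (b , _ , _ , Hb≡h , above) = a mod n , edge⇒spoke (recordLow⇒edge (a%m , low-a))
      where
      b≡ : b ≡ t + m * Σ< starts b
      b≡ = trans (sym (cong (_+ b) (*-zeroʳ m)))
        (trans (drop⇒ {0} {b} (trans t+h (cong (ℤ._+_ (+ t)) (sym Hb≡h)))) (+-identityʳ _))
      n≤b : n ≤ b
      n≤b = subst (n ≤_) (sym b≡) (≤-trans (m≤m+n n p) (m≤m+n t _))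
      a = b ∸ n
      a+n≡b : a + n ≡ b
      a+n≡b = m∸n+n≡m n≤b
      a%m : a % m ≡ p
      a%m = begin
        a % m                               ≡⟨ sym (%-remove-+ʳ a m∣n) ⟩
        (a + n) % m                         ≡⟨ cong (_% m) (trans a+n≡b b≡) ⟩
        (n + p + m * Σ< starts b) % m       ≡⟨ %-remove-+ʳ (n + p) {d = m} (m∣m*n (Σ< starts b)) ⟩
        (n + p) % m                         ≡⟨ %-remove-+ˡ p m∣n ⟩
        p % m                               ≡⟨ m<n⇒m%n≡m p<m ⟩
        p                                   ∎
        where open ≡-Reasoning
      low-a : Low a (a + n)
      low-a x x<a+n _ = subst (_⋖ H x) (trans (sym Hb≡h) (cong H (sym a+n≡b))) (above z≤n (subst (x <_) a+n≡b x<a+n))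

  private
    -- y minimizes H on the interval from a + 1 to a + k + 1, and H y lies e below
    -- the end of the longest chord found so far.  Unless all chords have been
    -- found, e < m; the next chord ends where e would become m.
    RunningMinimum : ℕ → ℕ → Set
    RunningMinimum a k = ∃[ y ] ∃[ e ]
      a < y × y ≤ suc (a + k) ×
      (∀ x → x ≤ suc (a + k) → a < x → H y ℤ.≤ H x) ×
      H (suc a) ≡ + (m * rank a k + e) ℤ.+ H y ×
      (rank a k ≡ starts a ⊎ rank a k < starts a × e < m)

    runningMinimum : ∀ a k → k ≤ N → RunningMinimum a k
    runningMinimum a zero _ = suc a , 0 , ≤-refl , s≤s (m≤m+n a 0) ,
      (λ x x≤ a<x → ℤ.≤-reflexive (cong H (≤-antisym a<x (subst (x ≤_) (cong suc (+-identityʳ a)) x≤)))) ,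
      sym (trans (cong (λ z → + z ℤ.+ H (suc a)) (trans (+-identityʳ (m * 0)) (*-zeroʳ m))) (ℤ.+-identityˡ _)) ,
      start (starts a)
      where
      start : ∀ q → 0 ≡ q ⊎ 0 < q × 0 < m
      start zero    = inj₁ refl
      start (suc _) = inj₂ (z<s , z<s)
    runningMinimum a (suc k) k<N with runningMinimum a k (<⇒≤ k<N)
    ... | y , e , a<y , y≤ , min , drop-y , saturated with H y ℤ.≤? H (a + suc (suc k))
    ...   | yes Hy≤Hb = y , e , a<y , ≤-trans y≤ (s≤s (+-monoʳ-≤ a (n≤1+n k))) , min′ ,
              subst (λ j → H (suc a) ≡ + (m * j + e) ℤ.+ H y) (sym rank≡) drop-y ,
              subst (λ j → j ≡ starts a ⊎ j < starts a × e < m) (sym rank≡) saturated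
      where
      b = a + suc (suc k)
      y<b : y < b
      y<b = subst (y <_) (sym (trans (+-suc a (suc k)) (cong suc (+-suc a k)))) (s≤s y≤)
      -- A chord that ends at `b` would make `b` lower than `y`.
      no-edge : ¬ T (chordAt a k)
      no-edge t = ⋖⇒≱ {H b} (edge⇒admissible (chord⇒edge a k t) .deep y y<b a<y) Hy≤Hb
      rank≡ : rank a (suc k) ≡ rank a k
      rank≡ = trans (cong (_+_ (rank a k)) (bit-¬T no-edge)) (+-identityʳ _)
      min′ : ∀ x → x ≤ suc (a + suc k) → a < x → H y ℤ.≤ H x
      min′ x x≤ a<x with m≤n⇒m<n∨m≡n x≤
      ... | inj₁ x<  = min x (subst (x ≤_) (+-suc a k) (s≤s⁻¹ x<)) a<x
      ... | inj₂ refl = subst (λ z → H y ℤ.≤ H z) (+-suc a (suc k)) Hy≤Hb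
    ...   | no Hy≰Hb = b , proj₁ new , m<m+n a z<s , ≤-reflexive (+-suc a (suc k)) , min′ , proj₂ new
      where
      b = a + suc (suc k)
      b≡ : b ≡ suc (suc (a + k))
      b≡ = trans (+-suc a (suc k)) (cong suc (+-suc a k))
      j = rank a k
      Hb⋖Hy : H b ⋖ H y
      Hb⋖Hy = ≰⇒⋗ Hy≰Hb
      -- The walk falls by at most 1 per step, so a new minimum undercuts the old one by exactly 1.
      Hy≡ : H y ≡ sucℤ (H b)
      Hy≡ = ℤ.≤-antisym (ℤ.≤-trans (min (suc (a + k)) ≤-refl (s≤s (m≤m+n a k)))
                                   (subst (λ z → H (suc (a + k)) ℤ.≤ sucℤ (H z)) (sym b≡) (H-step (suc (a + k))))) Hb⋖Hy
      min′ : ∀ x → x ≤ suc (a + suc k) → a < x → H b ℤ.≤ H x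
      min′ x x≤ a<x with m≤n⇒m<n∨m≡n x≤
      ... | inj₁ x<  = ℤ.≤-trans (⋖⇒≤ {H b} Hb⋖Hy) (min x (subst (x ≤_) (+-suc a k) (s≤s⁻¹ x<)) a<x)
      ... | inj₂ refl = ℤ.≤-reflexive (cong H (+-suc a (suc k)))
      drop-b : H (suc a) ≡ + (m * j + suc e) ℤ.+ H b
      drop-b = trans drop-y (trans (cong (ℤ._+_ (+ (m * j + e))) Hy≡)
        (trans (ex (+ (m * j + e)) (H b)) (cong (λ z → + z ℤ.+ H b) (sym (+-suc (m * j) e)))))
        where
        ex : ∀ x y → x ℤ.+ (1ℤ ℤ.+ y) ≡ 1ℤ ℤ.+ x ℤ.+ y
        ex = solve-∀
      deep-b : Low a b
      deep-b x x<b a<x = ℤ.≤-trans Hb⋖Hy (min x (s≤s⁻¹ (subst (x <_) b≡ x<b)) a<x)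
      shallow⇔b = shallow⇔ {hb = H b} (H-suc a) drop-b
      Goal : ℕ → Set
      Goal j′ = ∃[ e′ ] H (suc a) ≡ + (m * j′ + e′) ℤ.+ H b × (j′ ≡ starts a ⊎ j′ < starts a × e′ < m)
      m*1+j : suc e ≡ m → m * suc j ≡ m * j + suc e
      m*1+j e≡m = trans (*-suc m j) (trans (+-comm m (m * j)) (cong (_+_ (m * j)) (sym e≡m)))
      new : Goal (rank a (suc k))
      new with T? (chordAt a k)
      ... | yes t = subst Goal (sym rank≡) (accept saturated)
        where
        adm : Admissible a b
        adm = edge⇒admissible (chord⇒edge a k t)
        rank≡ : rank a (suc k) ≡ suc j
        rank≡ = rank-suc a k (chord⇒edge a k t)
        -- The residue condition makes the drop from `suc a` a multiple of m, so e has just reached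
        -- m - 1.
        m∣1+e : m ∣ suc e
        m∣1+e = ∣m+n∣m⇒∣n (drop⇒∣ (adm .residue) drop-b) (m∣m*n j)
        bounded : m * j + suc e ≤ m * starts a
        bounded = proj₁ shallow⇔b (adm .shallow)
        accept : j ≡ starts a ⊎ j < starts a × e < m → Goal (suc j)
        accept (inj₁ j≡) = contradiction bounded (<⇒≱ (subst (λ z → m * z < m * j + suc e) j≡ (m<m+n (m * j) z<s)))
        accept (inj₂ (j< , e<m)) = 0 , trans drop-b (cong (λ z → + z ℤ.+ H b) (trans (sym (m*1+j e≡m)) (sym (+-identityʳ _)))) ,
          closed
          where
          e≡m : suc e ≡ m
          e≡m = ≤-antisym e<m (∣⇒≤ m∣1+e)
          closed : suc j ≡ starts a ⊎ suc j < starts a × 0 < m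
          closed with m≤n⇒m<n∨m≡n j<
          ... | inj₁ 1+j< = inj₂ (1+j< , z<s)
          ... | inj₂ 1+j≡ = inj₁ 1+j≡
      ... | no ¬t = subst Goal (sym rank≡) (suc e , drop-b , reject saturated)
        where
        rank≡ : rank a (suc k) ≡ j
        rank≡ = trans (cong (_+_ j) (bit-¬T ¬t)) (+-identityʳ _)
        reject : j ≡ starts a ⊎ j < starts a × e < m → j ≡ starts a ⊎ j < starts a × suc e < m
        reject (inj₁ j≡) = inj₁ j≡
        reject (inj₂ (j< , e<m)) with m≤n⇒m<n∨m≡n e<m
        ... | inj₁ 1+e<m = inj₂ (j< , 1+e<m)
        -- At 1 + e = m all the conditions for an edge from `a` to `b` hold, so the chord cannot be
        -- missing.
        ... | inj₂ 1+e≡m = contradiction (edge⇒chordAt (admissible⇒edge record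
          { ordered = m<m+n a z<s
          ; residue = drop⇒≅ (suc j) (trans drop-b (cong (λ z → + z ℤ.+ H b) (sym (m*1+j 1+e≡m))))
          ; shallow = proj₂ shallow⇔b (subst (_≤ m * starts a) (m*1+j 1+e≡m) (*-monoʳ-≤ m j<))
          ; deep    = deep-b
          })) ¬t

  -- If chords were still missing after a full turn, the minimum over that turn would not yet have
  -- fallen below H a. But H (a + n) < H a.
  rank-starts : ∀ a → rank a N ≡ starts a
  rank-starts a with runningMinimum a N ≤-refl
  ... | _ , _ , _ , _ , _ , _ , inj₁ j≡ = j≡
  ... | y , e , a<y , y≤ , min , drop-y , inj₂ (j< , e<m) = contradiction Ha≤Hy (⋖⇒≱ {H y} Hy⋖Ha)
    where
    Hy⋖Ha : H y ⋖ H a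
    Hy⋖Ha = ℤ.≤-trans (suc-≤ (min (a + n) (≤-reflexive (+-suc a N)) (m<m+n a z<s))) (H-next a)
    ex : ∀ x y → x ℤ.+ (1ℤ ℤ.+ y) ≡ 1ℤ ℤ.+ x ℤ.+ y
    ex = solve-∀
    -- `shallow⇔` is used one level below the minimum: the drop is strictly less than m * starts a,
    -- and this gives H a ≤ H y instead of H a ≤ H y + 1.
    drop-pred : H (suc a) ≡ + suc (m * rank a N + e) ℤ.+ ℤ.pred (H y)
    drop-pred = trans drop-y (trans (cong (ℤ._+_ (+ (m * rank a N + e))) (sym (ℤ.suc-pred (H y))))
      (ex (+ (m * rank a N + e)) (ℤ.pred (H y))))
    below : suc (m * rank a N + e) ≤ m * starts a
    below = ≤-trans (subst (_≤ m * rank a N + m) (+-suc (m * rank a N) e) (+-monoʳ-≤ (m * rank a N) e<m))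
      (≤-trans (≤-reflexive (trans (+-comm (m * rank a N) m) (sym (*-suc m (rank a N))))) (*-monoʳ-≤ m j<))
    Ha≤Hy : H a ℤ.≤ H y
    Ha≤Hy = subst (H a ℤ.≤_) (ℤ.suc-pred (H y)) (proj₂ (shallow⇔ {hb = ℤ.pred (H y)} (H-suc a) drop-pred) below)

  chordCounts≡ : chordCounts ≡ c
  chordCounts≡ = trans (Vec.tabulate-cong λ i → trans (rank-starts (toℕ i))
    (cong (lookup c) (toℕ-mod-id i))) (Vec.tabulate∘lookup c)

  private
    -- H is lower after one turn, so the level H x - 1 is met. Its first hit satisfies `deep`, and
    -- the drop from x + 1 to it is m * starts x, which gives the residue.
    first-hit-edge : ∀ x → ∃[ y ] ChordEdge x y × H x ≡ sucℤ (H y)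
    first-hit-edge x = finish (hit h N (suc x) h≤ ≤h)
      where
      h = ℤ.pred (H x)
      h≤ : h ℤ.≤ H (suc x)
      h≤ = suc-≤⁻¹ (subst (ℤ._≤ sucℤ (H (suc x))) (sym (ℤ.suc-pred (H x))) (H-step x))
      ≤h : H (N + suc x) ℤ.≤ h
      ≤h = suc-≤⁻¹ (subst₂ ℤ._≤_ (cong (sucℤ ∘ H) (trans (+-comm x n) (sym (+-suc N x))))
        (sym (ℤ.suc-pred (H x))) (H-next x))
      finish : ∃[ y ] suc x ≤ y × y ≤ N + suc x × H y ≡ h × (∀ {z} → suc x ≤ z → z < y → h ⋖ H z) →
               ∃[ y ] ChordEdge x y × H x ≡ sucℤ (H y)
      finish (y , x<y , _ , Hy≡h , above) = y , admissible⇒edge record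
        { ordered = x<y
        ; residue = drop⇒≅ (starts x) (+-cancelˡ-≡ℤ 1ℤ (trans (H-suc x) (trans (cong (λ z → z ℤ.+ + (m * starts x)) Hx≡)
                      (ex (H y) (+ (m * starts x))))))
        ; shallow = ℤ.≤-reflexive Hx≡
        ; deep    = λ z z<y x<z → subst (_⋖ H z) (sym Hy≡h) (above x<z z<y)
        } , Hx≡
        where
        Hx≡ : H x ≡ sucℤ (H y)
        Hx≡ = trans (sym (ℤ.suc-pred (H x))) (cong sucℤ (sym Hy≡h))
        ex : ∀ y k → 1ℤ ℤ.+ y ℤ.+ k ≡ 1ℤ ℤ.+ (k ℤ.+ y)
        ex = solve-∀

  -- An edge that went past the first hit would end below H x - 1 and fail to be shallow.
  longest-edge-drop : ∀ {x y} → ChordEdge x y → (∀ {w} → ChordEdge x w → w ≤ y) → x ↘[ 1 ] y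
  longest-edge-drop {x} {y} e longest = finish (first-hit-edge x)
    where
    finish : ∃[ y′ ] ChordEdge x y′ × H x ≡ sucℤ (H y′) → x ↘[ 1 ] y
    finish (y′ , e′ , Hx≡) with m≤n⇒m<n∨m≡n (longest e′)
    ... | inj₂ refl = record { drop = Hx≡ ; low = edge⇒admissible e .deep }
    ... | inj₁ y′<y = contradiction (ℤ.≤-trans (ℤ.≤-reflexive (sym Hx≡)) (edge⇒admissible e .shallow))
      (λ p → ⋖⇒≱ {H y} (edge⇒admissible e .deep y′ y′<y (edge-< e′)) (suc-≤⁻¹ p))

  private
    finite : ℕ ⁺ → ℕ
    finite [ x ] = x
    finite ⊤⁺    = 0

    finite-source : ∀ {x y} → Edge angulation x y → x ≡ [ finite x ]
    finite-source (boundary a) = refl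
    finite-source (arc _ (chord _ _ _)) = refl
    finite-source (arc _ (spoke _ _)) = refl

    ≤-from-⁺ : ∀ {x y} → [ x ] <⁺ [ y ] ⊎ [ x ] ≡ [ y ] → x ≤ y
    ≤-from-⁺ (inj₁ [ x<y ]) = <⇒≤ x<y
    ≤-from-⁺ (inj₂ refl) = ≤-refl

    descent : (x : ℕ → ℕ) → ∀ i → (∀ j → j < i → x j ↘[ 1 ] x (suc j)) → x 0 ↘[ i ] x i
    descent x zero _ = ↘-refl
    descent x (suc i) steps = subst (λ k → x 0 ↘[ k ] x (suc i)) (+-comm i 1)
      (↘-trans (descent x i (λ j j<i → steps j (m<n⇒m<1+n j<i))) (steps i ≤-refl))

    multiple≡ : ∀ {r} → 1 ≤ r → m ∣ r → ¬ m < r → r ≡ m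
    multiple≡ 1≤r m∣r m≮r = ≤-antisym (≮⇒≥ m≮r) (∣⇒≤ {{>-nonZero 1≤r}} m∣r)

    -- From the second corner on, the sides are longest edges, and each lowers H by 1. The first
    -- side and the base start at the same corner, so their ends are congruent mod m and m divides
    -- r. If r exceeded m, the edge from the first corner to the point m sides further than the
    -- second would be admissible, hence a diagonal.
    finite-polygon : ∀ {r v b} → Polygon angulation r v → v (suc r) ≡ [ b ] → r ≡ m
    finite-polygon {r} {v} {b} pg last≡ = multiple≡ nonempty
      (drop⇒∣ {x 0} {x r} (trans (sym (first .residue)) (base-admissible .residue)) (x₀↘ ≤-refl .drop)) m≮r
      where
      open Polygon pg
      a = finite (v 0)
      x : ℕ → ℕ
      x i = finite (v (suc i))
      at : ∀ {i} → i ≤ r → v (suc i) ≡ [ x i ]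
      at {i} i≤r with m≤n⇒m<n∨m≡n i≤r
      ... | inj₁ i<r  = finite-source (side (suc i) i<r)
      ... | inj₂ refl = trans last≡ (cong ([_] ∘ finite) (sym last≡))
      edge : ∀ {i} → i < r → ChordEdge (x i) (x (suc i))
      edge {i} i<r = subst₂ (Edge angulation) (at (<⇒≤ i<r)) (at i<r) (side (suc i) i<r)
      step : ∀ i → i < r → x i ↘[ 1 ] x (suc i)
      step i i<r = longest-edge-drop (edge i<r) λ {w} e → ≤-from-⁺
        (subst (λ z → [ w ] <⁺ z ⊎ [ w ] ≡ z) (at i<r)
          (edge-from-inner nonCrossing pg (s≤s z≤n) i<r (subst (λ z → Edge angulation z [ w ]) (sym (at (<⇒≤ i<r))) e)))
      x₀↘ : ∀ {i} → i ≤ r → x 0 ↘[ i ] x i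
      x₀↘ {i} i≤r = descent x i (λ j j<i → step j (<-≤-trans j<i i≤r))
      base-admissible : Admissible a (x r)
      base-admissible = edge⇒admissible (subst₂ (Edge angulation) (finite-source base) (at ≤-refl) base)
      x-mono : ∀ {i} → i < r → x i < x r
      x-mono i<r = [<]-injective (subst₂ _<⁺_ (at (<⇒≤ i<r)) (at ≤-refl) (corner-mono side (s≤s i<r) ≤-refl))
      first : Admissible a (x 0)
      first = edge⇒admissible (subst₂ (Edge angulation) (finite-source base) (at z≤n) (side 0 z≤n))
      m≮r : ¬ m < r
      m≮r m<r = contradiction
        (no-diagonal (s≤s z<s) (s≤s (<⇒≤ m<r))
          (subst₂ (Edge angulation) (sym (finite-source base)) (sym (at (<⇒≤ m<r))) (admissible⇒edge diagonal)))
        (λ (_ , m≡r) → <-irrefl (suc-injective m≡r) m<r)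
        where
        x₀↘xₘ = x₀↘ (<⇒≤ m<r)
        x₀<xₘ : a < x m
        x₀<xₘ = [<]-injective (subst₂ _<⁺_ (finite-source base) (at (<⇒≤ m<r))
          (corner-mono side (s≤s z≤n) (s≤s (<⇒≤ m<r))))
        diagonal : Admissible a (x m)
        diagonal = record
          { ordered = x₀<xₘ
          ; residue = trans (first .residue) (drop⇒≅ 1
              (trans (x₀↘xₘ .drop) (cong (λ z → + z ℤ.+ H (x m)) (sym (*-identityʳ m)))))
          ; shallow = ℤ.≤-trans (base-admissible .shallow)
              (ℤ.≤-trans (base-admissible .deep (x m) (x-mono m<r) x₀<xₘ) (ℤ.i≤suc[i] (H (x m))))
          ; deep    = Low-trans (↘-⋖ x₀↘xₘ) (first .deep) (x₀↘xₘ .low)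
          }

    -- Here the first side is a longest edge as well, since the base is a spoke. Both spokes lie in
    -- the class p, so m divides r; if r exceeded m, the corner m sides after the first would be a
    -- record low, and its spoke a diagonal.
    infinite-polygon : ∀ {r v} → Polygon angulation r v → v (suc r) ≡ ⊤⁺ → r ≡ m
    infinite-polygon {r} {v} pg last≡ = multiple≡ nonempty
      (drop⇒∣ {x 0} {x r} (trans (proj₁ (low-at 0 z≤n base-spoke)) (sym (proj₁ (low-at r ≤-refl last-spoke))))
        (x₀↘ ≤-refl .drop)) m≮r
      where
      open Polygon pg
      x : ℕ → ℕ
      x i = finite (v i)
      at : ∀ {i} → i ≤ r → v i ≡ [ x i ]
      at {i} i≤r = finite-source (side i i≤r)
      edge : ∀ {i} → i < r → ChordEdge (x i) (x (suc i))
      edge {i} i<r = subst₂ (Edge angulation) (at (<⇒≤ i<r)) (at i<r) (side i (<⇒≤ i<r))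
      longest : ∀ i {w} → i < r → Edge angulation (v i) [ w ] → [ w ] <⁺ v (suc i) ⊎ [ w ] ≡ v (suc i)
      longest zero {w} _ e = edge-from-first nonCrossing pg e (subst ([ w ] <⁺_) (sym last≡) [ w ]<⊤⁺)
      longest (suc i) i<r e = edge-from-inner nonCrossing pg (s≤s z≤n) (<⇒≤ i<r) e
      step : ∀ i → i < r → x i ↘[ 1 ] x (suc i)
      step i i<r = longest-edge-drop (edge i<r) λ {w} e → ≤-from-⁺
        (subst (λ z → [ w ] <⁺ z ⊎ [ w ] ≡ z) (at i<r)
          (longest i i<r (subst (λ z → Edge angulation z [ w ]) (sym (at (<⇒≤ i<r))) e)))
      x₀↘ : ∀ {i} → i ≤ r → x 0 ↘[ i ] x i
      x₀↘ {i} i≤r = descent x i (λ j j<i → step j (<-≤-trans j<i i≤r))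
      low-at : ∀ i → i ≤ r → Edge angulation (v i) ⊤⁺ → RecordLow (x i)
      low-at i i≤r e = edge⇒recordLow (subst (λ z → Edge angulation z ⊤⁺) (at i≤r) e)
      base-spoke : Edge angulation (v 0) ⊤⁺
      base-spoke = subst (Edge angulation (v 0)) last≡ base
      last-spoke : Edge angulation (v r) ⊤⁺
      last-spoke = subst (Edge angulation (v r)) last≡ (side r ≤-refl)
      m≮r : ¬ m < r
      m≮r m<r = contradiction
        (no-diagonal (s≤s m<r) ≤-refl (subst₂ (Edge angulation) (sym (at (<⇒≤ m<r))) (sym last≡) (recordLow⇒edge low-m)))
        (λ { (() , _) })
        where
        x₀↘xₘ = x₀↘ (<⇒≤ m<r)
        low-m : RecordLow (x m)
        low-m = recordLow-next (low-at 0 z≤n base-spoke)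
          ([<]-injective (subst₂ _<⁺_ (at z≤n) (at (<⇒≤ m<r)) (corner-mono side z<s (m≤n⇒m≤1+n (<⇒≤ m<r)))))
          (↘-⋖ x₀↘xₘ) (x₀↘xₘ .low)
          (drop⇒≅ 1 (trans (x₀↘xₘ .drop) (cong (λ z → + z ℤ.+ H (x m)) (sym (*-identityʳ m)))))

  isAngulation : IsAngulation m angulation
  isAngulation = record
    { nonCrossing    = nonCrossing
    ; hasSpoke       = hasSpoke
    ; all-[m+2]-gons = λ k pc → polygonal (component⇒polygon pc)
    }
    where
    polygonal : ∀ {k} → ∃[ r ] k ≡ suc (suc r) × ∃[ v ] Polygon angulation r v → k ≡ m + 2
    polygonal (r , refl , v , pg) = trans (cong (λ q → suc (suc q)) (r≡m (v (suc r)) refl)) (+-comm 2 m)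
      where
      r≡m : ∀ w → v (suc r) ≡ w → r ≡ m
      r≡m [ b ] = finite-polygon pg
      r≡m ⊤⁺    = infinite-polygon pg

  -- Once the chord counts are known to be c, `euler` and `n≡` leave only this value.
  #spokes≡ : #spokes angulation ≡ suc s
  #spokes≡ = *-cancelˡ-≡ _ _ m (+-cancelˡ-≡ (m * sum c) _ _ (trans (sym (*-distribˡ-+ m (sum c) _))
    (trans (cong (λ z → m * (sum z + #spokes angulation)) (sym chordCounts≡)) (trans (sym euler) n≡))))
    where open Angulation angulation isAngulation using (euler)

-- Counting weak compositions

Composition : ℕ → ℕ → Set
Composition n p = Σ[ c ∈ Vec ℕ n ] sum c ≡ p

Composition-≡ : ∀ {n p} {c d : Composition n p} → proj₁ c ≡ proj₁ d → c ≡ d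
Composition-≡ {c = c , e} {.c , e′} refl = cong (c ,_) (≡-irrelevant e e′)

compositions-singleton : ∀ p → Composition 1 p ↔ Fin 1
compositions-singleton p = mk↔ₛ′ (λ _ → zero) (λ _ → p ∷ [] , +-identityʳ p) (λ { zero → refl })
  λ { (x ∷ [] , e) → Composition-≡ (cong (_∷ []) (trans (sym e) (+-identityʳ x))) }

compositions-zero : ∀ n → Composition (suc n) 0 ↔ Composition n 0
compositions-zero n = mk↔ₛ′
  (λ { (zero ∷ c , e) → c , e })
  (λ (c , e) → zero ∷ c , e)
  (λ _ → refl)
  λ { (zero ∷ c , e) → refl }

-- Either the first entry is 0 and is removed, or it is positive and is lowered by 1. This is the
-- split behind Pascal's rule.
compositions-suc : ∀ n p → Composition (suc n) (suc p) ↔ (Composition n (suc p) ⊎ Composition (suc n) p)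
compositions-suc n p = mk↔ₛ′
  (λ { (zero ∷ c , e) → inj₁ (c , e) ; (suc x ∷ c , e) → inj₂ (x ∷ c , suc-injective e) })
  (λ { (inj₁ (c , e)) → zero ∷ c , e ; (inj₂ (x ∷ c , e)) → suc x ∷ c , cong suc e })
  (λ { (inj₁ _) → refl ; (inj₂ (x ∷ c , e)) → cong inj₂ (Composition-≡ refl) })
  λ { (zero ∷ c , e) → refl ; (suc x ∷ c , e) → Composition-≡ refl }

≡⇒Fin↔ : ∀ {a b} → a ≡ b → Fin a ↔ Fin b
≡⇒Fin↔ refl = ↔-refl

compositions : ∀ N p → Composition (suc N) p ↔ Fin ((N + p) C N)
compositions zero p = ↔-trans (compositions-singleton p) (≡⇒Fin↔ refl)
compositions (suc N) zero = ↔-trans (compositions-zero (suc N)) (↔-trans (compositions N zero)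
  (≡⇒Fin↔ (trans (cong (_C N) (+-identityʳ N)) (trans (nCn≡1 N)
    (sym (trans (cong (_C suc N) (+-identityʳ (suc N))) (nCn≡1 (suc N))))))))
compositions (suc N) (suc p) = ↔-trans (compositions-suc (suc N) p)
  (↔-trans (compositions N (suc p) ⊎-↔ compositions (suc N) p)
  (↔-trans (↔-sym Fin.+↔⊎)
  (≡⇒Fin↔ (trans (cong (λ k → (N + suc p) C N + k C suc N) (sym (+-suc N p)))
    (nCk+nC[k+1]≡[n+1]C[k+1] (N + suc p) N)))))

-- The bijection between angulations and codes

T-ext : ∀ {a b} → (T a → T b) → (T b → T a) → a ≡ b
T-ext {true}  {true}  _ _ = refl
T-ext {true}  {false} f _ = contradiction _ f
T-ext {false} {true}  _ g = contradiction _ g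
T-ext {false} {false} _ _ = refl

module _ {M N : ℕ} {S : ArcSet (suc N)} (ang : IsAngulation (suc M) S) where
  open Angulation S ang
  open Edges S

  -- The residue class mod m of all spokes; by `spoke-phase` it does not depend on the spoke chosen.
  phase : Fin (suc M)
  phase = proj₁ somewhere mod suc M

  spoke-phase : ∀ {a} → SpokeEdge a → a % suc M ≡ toℕ phase
  spoke-phase {a} sa = trans (same (<-cmp a (proj₁ somewhere))) (sym (toℕ-mod (proj₁ somewhere) (suc M)))
    where
    same : _ → a % suc M ≡ proj₁ somewhere % suc M
    same (tri< a< _ _) = spokes-residue sa (proj₂ somewhere) a<
    same (tri≈ _ a≡ _) = cong (_% suc M) a≡
    same (tri> _ _ >a) = sym (spokes-residue (proj₂ somewhere) sa >a)

chordCounts-cong : ∀ {N} {S S′ : ArcSet (suc N)} → (∀ α → S α ≡ S′ α) → Ranks.chordCounts S ≡ Ranks.chordCounts S′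
chordCounts-cong {N} {S} {S′} S≗S′ = Vec.tabulate-cong λ i → Σ<-cong (λ d → cong bit (chordAt≡ (toℕ i) d)) N
  where
  chordAt≡ : ∀ a d → Edges.chordAt S a d ≡ Edges.chordAt S′ a d
  chordAt≡ a d with d <? N
  ... | yes d<N = S≗S′ (chord (a mod suc N) (fromℕ< d<N))
  ... | no  _   = refl

angulation-determined : ∀ {M N} {S S′ : ArcSet (suc N)} (ang : IsAngulation (suc M) S) (ang′ : IsAngulation (suc M) S′) →
                        Ranks.chordCounts S ≡ Ranks.chordCounts S′ → phase ang ≡ phase ang′ → ∀ α → S α ≡ S′ α
angulation-determined {M} {N} {S} {S′} ang ang′ counts≡ phase≡ α =
  T-ext (transfer ang ang′ (sym counts≡) phase≡ α) (transfer ang′ ang counts≡ (sym phase≡) α)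
  where
  n = suc N
  transfer : ∀ {S S′ : ArcSet n} (ang : IsAngulation (suc M) S) (ang′ : IsAngulation (suc M) S′) →
             Ranks.chordCounts S′ ≡ Ranks.chordCounts S → phase ang ≡ phase ang′ → ∀ α → α ∈ S → α ∈ S′
  transfer {S} {S′} ang ang′ counts≡ phase≡ (chord i d) t = subst T (at S′)
    (Comparison.chord-transfer ang ang′ counts≡ (toℕ i) (toℕ d) (subst T (sym (at S)) t))
    where
    at : ∀ S → Edges.chordAt S (toℕ i) (toℕ d) ≡ S (chord i d)
    at S = trans (Edges.chordAt-toℕ S (toℕ i) d) (cong (λ j → S (chord j d)) (toℕ-mod-id i))
  transfer {S} {S′} ang ang′ counts≡ phase≡ (spoke i) t = subst T (at S′) (Edges.edge⇒spoke S′
    (Comparison.spoke-transfer ang ang′ counts≡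
      (λ sa sb → trans (spoke-phase ang sa) (trans (cong toℕ phase≡) (sym (spoke-phase ang′ sb))))
      (toℕ i) (Edges.spoke⇒edge S (toℕ i) (subst T (sym (at S)) t))))
    where
    at : ∀ S → Edges.spokeAt S (toℕ i) ≡ S (spoke i)
    at S = cong (S ∘ spoke) (toℕ-mod-id i)

module Encoding {M N ℓ s : ℕ} (n≡mℓ : suc N ≡ suc M * ℓ) (s≤ℓ : suc s ≤ ℓ) where
  private
    m = suc M
    n = suc N
    P = ℓ ∸ suc s

    Code : Set
    Code = Composition n P × Fin m

    module A = Setoid (Angulations m n (suc s))

    n≡ : ∀ {p} → p ≡ P → n ≡ m * p + m * suc s
    n≡ refl = trans n≡mℓ (trans (cong (m *_) (sym (m∸n+n≡m s≤ℓ))) (*-distribˡ-+ m P (suc s)))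

    module B (c : Composition n P) (p : Fin m) = Construction (proj₁ c) (Fin.toℕ<n p) (n≡ (proj₂ c))

    to : A.Carrier → Code
    to (S , ang , e) = (Ranks.chordCounts S , total) , phase ang
      where
      total : sum (Ranks.chordCounts S) ≡ P
      total = trans (sym (m+n∸n≡m (sum (Ranks.chordCounts S)) (suc s))) (cong (_∸ suc s)
        (*-cancelˡ-≡ _ ℓ m (trans (cong (λ z → m * (sum (Ranks.chordCounts S) + z)) (sym e))
          (trans (sym (Angulation.euler S ang)) n≡mℓ))))

    from : Code → A.Carrier
    from (c , p) = B.angulation c p , B.isAngulation c p , B.#spokes≡ c p

    to-cong : ∀ {x y} → x A.≈ y → to x ≡ to y
    to-cong {S , ang , e} {S′ , ang′ , e′} S≗S′ = cong₂ _,_ (Composition-≡ (chordCounts-cong S≗S′))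
      (Fin.toℕ-injective (trans (sym (spoke-phase ang {a} sp)) (spoke-phase ang′ {a} sp′)))
      where
      a = proj₁ (Angulation.somewhere S ang)
      sp = proj₂ (Angulation.somewhere S ang)
      sp′ = Edges.spoke⇒edge S′ a (subst T (S≗S′ _) (Edges.edge⇒spoke S sp))

    to-from : ∀ y → to (from y) ≡ y
    to-from (c , p) = cong₂ _,_ (Composition-≡ (B.chordCounts≡ c p))
      (Fin.toℕ-injective (trans (sym (spoke-phase (B.isAngulation c p) {a} sp)) (proj₁ (B.edge⇒recordLow c p {a} sp))))
      where
      a = proj₁ (Angulation.somewhere (B.angulation c p) (B.isAngulation c p))
      sp = proj₂ (Angulation.somewhere (B.angulation c p) (B.isAngulation c p))

    from-to : ∀ x → from (to x) A.≈ x
    -- The code determines the angulation, so it is enough that `from (to x)` and `x` have the same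
    -- code, which is `to-from` at `to x`.
    from-to x@(S , ang , e) = angulation-determined (proj₁ (proj₂ (from (to x)))) ang
      (cong (proj₁ ∘ proj₁) (to-from (to x))) (cong proj₂ (to-from (to x)))

  encoding : Inverse (Angulations m n (suc s)) (setoid Code)
  encoding = record
    { to        = to
    ; from      = from
    ; to-cong   = λ {x} {y} → to-cong {x} {y}
    ; from-cong = λ { refl α → refl }
    ; inverse   = (λ {x} {y} y≈ → trans (to-cong {y} {from x} y≈) (to-from x))
                , (λ { {x} refl → from-to x })
    }

  count : HasCardinality (Angulations m n (suc s)) (m * ((N + P) C N))
  count = Compose.inverse encoding (↔-trans (×-comm _ _) (↔-trans (↔-refl ×-↔ compositions N P) (↔-sym Fin.*↔×)))

theorem3p4 : (m ℓ n s : ℕ) → 1 ≤ m → 1 ≤ ℓ → n ≡ m * ℓ → 1 ≤ s → s ≤ ℓ →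
    HasCardinality (Angulations m n s) (m * ((n + ℓ ∸ s ∸ 1) C (n ∸ 1)))
theorem3p4 (suc M) ℓ (suc N) (suc s) _ _ n≡mℓ _ s≤ℓ =
  subst (λ k → HasCardinality (Angulations (suc M) (suc N) (suc s)) (suc M * (k C N)))
    (sym (cong (_∸ 1) (+-∸-assoc (suc N) s≤ℓ)))
    (Encoding.count n≡mℓ s≤ℓ)
theorem3p4 (suc M) (suc L) zero _ _ _ () _ _
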